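{- Let $r \ge 2$ be an integer. There is a constant $c = c(r) > 0$, depending only on $r$, such that for all integers $n \ge r$, \[\overrightarrow{\Gamma}_{r-1}(H(n,r)) \ge c\,(\ln n)^{\frac{1}{r-1}}.\]
   Context: $H(n,r)$ denotes the complete $r$-uniform hypergraph on $n$ vertices (every $r$-subset of the $n$-element vertex set is an edge). An orientation $D$ of an $r$-uniform hypergraph $H=(V,\mathcal{E})$ assigns to each edge $E\in\mathcal{E}$ exactly one of the $r!$ linear orderings of its elements. For $1\le p\le r-1$, a set $S\subseteq V$ is a directed $p$-dominating set of $D$ if for every vertex $u\in V\setminus S$ there is an edge $E\in\mathcal{E}$ with $u\in E$ whose first $p$ vertices (in the ordering given by $D$) all lie in $S$. $\overrightarrow{\gamma}_p(D)$ is the minimum cardinality of a directed $p$-dominating set of $D$, and $\overrightarrow{\Gamma}_p(H)$ is the maximum of $\overrightarrow{\gamma}_p(D)$ over all orientations $D$ of $H$. $\ln$ is the natural logarithm. -}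

module Defs where

import Algebra.Definitions.RawSemiring
open import Data.Bool using (true; false)
open import Data.Fin using (Fin; zero; suc; toℕ)
open import Data.Fin.Properties using (suc-injective; all?) renaming (_≟_ to _≟ᶠ_)
open import Data.Fin.Subset using (Subset; inside; outside; _∈_; _∉_; ∣_∣; ⊤)
open import Data.Fin.Subset.Properties using (_∈?_; anySubset?; ∈⊤; ∣⊤∣≡n)
open import Data.Integer using (+_)
open import Data.List as List
  using (List; []; _∷_; cartesianProductWith; allFin; concatMap; filter)
open import Data.List.Membership.Propositional using (find) renaming (_∈_ to _∈ᴸ_)
open import Data.List.Membership.Propositional.Properties
  using (∈-allFin; ∈-map⁺; ∈-map⁻; ∈-filter⁺; ∈-filter⁻)
import Data.List.Extrema
import Data.List.Relation.Unary.All as AllL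
open import Data.List.Relation.Unary.Any as AnyL using (Any; here; there)
import Data.List.Relation.Unary.Any.Properties as AnyLₚ
open import Data.Nat as ℕ using (ℕ; zero; suc; NonZero; _!; _∸_)
open import Data.Nat.Properties as ℕₚ using (_!≢0)
open import Data.Product using (∃; Σ-syntax; _×_; _,_; proj₂)
open import Data.Rational using (ℚ; 0ℚ; 1ℚ; _/_; _+_; _*_; _<_; _≤_; nonNegative)
open import Data.Rational.Base using (+-*-rawSemiring)
import Data.Rational.Properties as ℚₚ
open import Data.Sum using (_⊎_; inj₁; inj₂)
open import Data.Vec as Vec using (Vec; []; _∷_; lookup; here; there)
open import Data.Vec.Relation.Unary.All as AllV using (All; []; _∷_)
import Data.Vec.Relation.Unary.All.Properties as AllVₚ
open import Data.Vec.Relation.Unary.AllPairs as AllPairsV using ([]; _∷_)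
open import Data.Vec.Relation.Unary.Unique.Propositional using (Unique)
import Data.Vec.Relation.Unary.Unique.Propositional.Properties as Uniqueₚ
open import Function using (_∘_)
open import Relation.Binary.PropositionalEquality
  using (_≡_; refl; sym; trans; cong; subst)
open import Relation.Binary.Definitions using (tri<; tri≈; tri>)
open import Relation.Nullary using (¬_; Dec; yes; no; ¬?; contradiction)
open import Relation.Nullary.Decidable using (_×-dec_; _→-dec_; map′)

open Algebra.Definitions.RawSemiring +-*-rawSemiring using () renaming (_^_ to _^ℚ_) public
open Data.List.Extrema ℕₚ.≤-totalOrder
  using (min; max; min≤xs; xs≤max; argmin-sel; argmax-sel)

------------------------------------------------------------------------
-- Hypergraphs and orientations

record Hypergraph (n r : ℕ) : Set₁ where
  field
    Edge    : Subset n → Set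
    Edge?   : ∀ E → Dec (Edge E)
    uniform : ∀ {E} → Edge E → ∣ E ∣ ≡ r

open Hypergraph public

H : (n r : ℕ) → Hypergraph n r
H n r = record
  { Edge    = λ E → ∣ E ∣ ≡ r
  ; Edge?   = λ E → ∣ E ∣ ℕ.≟ r
  ; uniform = λ e → e
  }

-- Since `order` has length ∣ E ∣, being duplicate-free and contained
-- in E forces it to list every element of E exactly once.
record LinearOrdering {n : ℕ} (E : Subset n) : Set where
  constructor mkOrdering
  field
    order    : Vec (Fin n) ∣ E ∣
    within   : All (_∈ E) order
    distinct : Unique order

open LinearOrdering public

-- The proof of being an edge is irrelevant, so that the ordering
-- depends only on the edge itself.
Orientation : ∀ {n r} → Hypergraph n r → Set
Orientation 𝓗 = ∀ E → .(Edge 𝓗 E) → LinearOrdering E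

FirstIn : ∀ {n} → ℕ → {E : Subset n} → LinearOrdering E → Subset n → Set
FirstIn p {E} o S = ∀ (i : Fin ∣ E ∣) → toℕ i ℕ.< p → lookup (order o) i ∈ S

firstIn? : ∀ {n} p {E : Subset n} (o : LinearOrdering E) S → Dec (FirstIn p o S)
firstIn? p o S =
  all? λ i → (toℕ i ℕ.<? p) →-dec (lookup (order o) i ∈? S)

module _ {n r : ℕ} (𝓗 : Hypergraph n r) where

  Dominating : ℕ → Orientation 𝓗 → Subset n → Set
  Dominating p D S =
    ∀ u → u ∉ S → ∃ λ E → Σ[ e ∈ Edge 𝓗 E ] (u ∈ E × FirstIn p (D E e) S)

  dominating? : ∀ p (D : Orientation 𝓗) S → Dec (Dominating p D S)
  dominating? p D S = all? λ u → ¬? (u ∈? S) →-dec anySubset? (witness? u)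
    where
    witness? : ∀ u E → Dec (Σ[ e ∈ Edge 𝓗 E ] (u ∈ E × FirstIn p (D E e) S))
    witness? u E with Edge? 𝓗 E
    ... | no ¬e = no λ (e , _) → ¬e e
    ... | yes e = map′ (e ,_) proj₂ ((u ∈? E) ×-dec firstIn? p (D E e) S)

------------------------------------------------------------------------
-- Finite enumerations

vecs : ∀ {A : Set} → List A → (k : ℕ) → List (Vec A k)
vecs xs zero    = [] ∷ []
vecs xs (suc k) = cartesianProductWith _∷_ xs (vecs xs k)

vecs-complete : ∀ {A : Set} {xs : List A} → (∀ a → a ∈ᴸ xs) →
                ∀ {k} (v : Vec A k) → v ∈ᴸ vecs xs k
vecs-complete full []      = here refl
vecs-complete full (a ∷ v) =
  AnyLₚ.cartesianProductWith⁺ _∷_ (λ { refl refl → refl })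
    (full a) (vecs-complete full v)

subsets : ∀ n → List (Subset n)
subsets = vecs (inside ∷ outside ∷ [])

subsets-complete : ∀ {n} (S : Subset n) → S ∈ᴸ subsets n
subsets-complete = vecs-complete λ { true → here refl ; false → there (here refl) }

-- All dependent functions E ↦ f E with f E drawn from the list xs E.
choices : ∀ {n} {A : Subset n → Set} → (∀ E → List (A E)) → List (∀ E → A E)
choices {zero}  xs = List.map (λ { a [] → a }) (xs [])
choices {suc n} xs =
  cartesianProductWith (λ { f g (inside ∷ E) → f E ; f g (outside ∷ E) → g E })
    (choices (xs ∘ (inside ∷_))) (choices (xs ∘ (outside ∷_)))

choices-complete : ∀ {n} {A : Subset n → Set} {P : ∀ E → A E → Set}
                   (xs : ∀ E → List (A E)) → (∀ E → Any (P E) (xs E)) →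
                   Any (λ f → ∀ E → P E (f E)) (choices xs)
choices-complete {zero}  xs any = AnyLₚ.map⁺ (AnyL.map (λ { p [] → p }) (any []))
choices-complete {suc n} xs any =
  AnyLₚ.cartesianProductWith⁺ _
    (λ { p q (true ∷ E) → p E ; p q (false ∷ E) → q E })
    (choices-complete _ (any ∘ (inside ∷_)))
    (choices-complete _ (any ∘ (outside ∷_)))

module _ {n : ℕ} (E : Subset n) where

  isOrdering? : (v : Vec (Fin n) ∣ E ∣) → Dec (All (_∈ E) v × Unique v)
  isOrdering? v = AllV.all? (_∈? E) v
            ×-dec AllPairsV.allPairs? (λ x y → ¬? (x ≟ᶠ y)) v

  orderingsOf : Vec (Fin n) ∣ E ∣ → List (LinearOrdering E)
  orderingsOf v with isOrdering? v
  ... | yes (w , d) = mkOrdering v w d ∷ []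
  ... | no  _       = []

  orderings : List (LinearOrdering E)
  orderings = concatMap orderingsOf (vecs (allFin n) ∣ E ∣)

  orderings-complete : (o : LinearOrdering E) →
                       Any (λ o′ → order o′ ≡ order o) orderings
  orderings-complete o =
    AnyLₚ.concatMap⁺ orderingsOf
      (AnyL.map (λ { refl → listed }) (vecs-complete ∈-allFin (order o)))
    where
    listed : Any (λ o′ → order o′ ≡ order o) (orderingsOf (order o))
    listed with isOrdering? (order o)
    ... | yes _ = here refl
    ... | no ¬p = contradiction (within o , distinct o) ¬p

increasing : ∀ {n} (E : Subset n) → LinearOrdering E
increasing []            = mkOrdering [] [] []
increasing (outside ∷ E) with increasing E
... | mkOrdering v w d =
  mkOrdering (Vec.map suc v) (AllVₚ.gmap there w) (Uniqueₚ.map⁺ suc-injective d)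
increasing (inside ∷ E)  with increasing E
... | mkOrdering v w d =
  mkOrdering (zero ∷ Vec.map suc v)
             (here ∷ AllVₚ.gmap there w)
             (AllVₚ.map⁺ (AllV.universal (λ _ ()) v) ∷ Uniqueₚ.map⁺ suc-injective d)

module _ {n r : ℕ} (𝓗 : Hypergraph n r) where

  orientationsAt : ∀ E → List (.(Edge 𝓗 E) → LinearOrdering E)
  orientationsAt E with Edge? 𝓗 E
  ... | yes _ = List.map (λ o _ → o) (orderings E)
  ... | no  _ = (λ _ → increasing E) ∷ []

  orientations : List (Orientation 𝓗)
  orientations = choices orientationsAt

  -- Complete up to pointwise equality of the underlying orders.
  orientations-complete : (D : Orientation 𝓗) →
    Any (λ D′ → ∀ E (e : Edge 𝓗 E) → order (D′ E e) ≡ order (D E e)) orientations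
  orientations-complete D = choices-complete orientationsAt at
    where
    at : ∀ E → Any (λ d → (e : Edge 𝓗 E) → order (d e) ≡ order (D E e)) (orientationsAt E)
    at E with Edge? 𝓗 E
    ... | yes e = AnyLₚ.map⁺ (AnyL.map (λ eq _ → eq) (orderings-complete E (D E e)))
    ... | no ¬e = here λ e → contradiction e ¬e

------------------------------------------------------------------------
-- Domination numbers

module _ {n r : ℕ} (𝓗 : Hypergraph n r) where

  -- The starting value n of the minimum is the size of the dominating
  -- set of all vertices.
  γ : ℕ → Orientation 𝓗 → ℕ
  γ p D = min n (List.map ∣_∣ (filter (dominating? 𝓗 p D) (subsets n)))

  γ-attained : ∀ p D → ∃ λ S → Dominating 𝓗 p D S × ∣ S ∣ ≡ γ p D
  γ-attained p D
    with argmin-sel (λ k → k) n (List.map ∣_∣ (filter (dominating? 𝓗 p D) (subsets n)))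
  ... | inj₁ eq = ⊤ , (λ u u∉⊤ → contradiction ∈⊤ u∉⊤) , trans (∣⊤∣≡n n) (sym eq)
  ... | inj₂ γ∈ with ∈-map⁻ ∣_∣ γ∈
  ...   | S , S∈ , eq = S , proj₂ (∈-filter⁻ (dominating? 𝓗 p D) {xs = subsets n} S∈) , sym eq

  γ-least : ∀ p D S → Dominating 𝓗 p D S → γ p D ℕ.≤ ∣ S ∣
  γ-least p D S dom =
    AllL.lookup (min≤xs n _)
      (∈-map⁺ ∣_∣ (∈-filter⁺ (dominating? 𝓗 p D) (subsets-complete S) dom))

  γ-mono : ∀ p (D D′ : Orientation 𝓗) →
           (∀ E (e : Edge 𝓗 E) → order (D′ E e) ≡ order (D E e)) →
           γ p D ℕ.≤ γ p D′
  γ-mono p D D′ eq with γ-attained p D′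
  ... | S , dom , ∣S∣≡γ = subst (γ p D ℕ.≤_) ∣S∣≡γ (γ-least p D S λ u u∉S → transfer (dom u u∉S))
    where
    transfer : ∀ {u} → (∃ λ E → Σ[ e ∈ Edge 𝓗 E ] (u ∈ E × FirstIn p (D′ E e) S)) →
               ∃ λ E → Σ[ e ∈ Edge 𝓗 E ] (u ∈ E × FirstIn p (D E e) S)
    transfer (E , e , u∈E , first) =
      E , e , u∈E , λ i i<p → subst (λ v → lookup v i ∈ S) (eq E e) (first i i<p)

Γ : ∀ {n r} → ℕ → Hypergraph n r → ℕ
Γ p 𝓗 = max 0 (List.map (γ 𝓗 p) (orientations 𝓗))

module _ {n r : ℕ} (p : ℕ) (𝓗 : Hypergraph n r) where

  Γ-greatest : (D : Orientation 𝓗) → γ 𝓗 p D ℕ.≤ Γ p 𝓗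
  Γ-greatest D with find (orientations-complete 𝓗 D)
  ... | D′ , D′∈ , eq =
    ℕₚ.≤-trans (γ-mono 𝓗 p D D′ eq) (AllL.lookup (xs≤max 0 _) (∈-map⁺ (γ 𝓗 p) D′∈))

  Γ-attained : ∃ λ (D : Orientation 𝓗) → γ 𝓗 p D ≡ Γ p 𝓗
  Γ-attained with argmax-sel (λ k → k) 0 (List.map (γ 𝓗 p) (orientations 𝓗))
  ... | inj₁ Γ≡0 = D₀ , trans (ℕₚ.n≤0⇒n≡0 (subst (γ 𝓗 p D₀ ℕ.≤_) Γ≡0 (Γ-greatest D₀))) (sym Γ≡0)
    where
    D₀ : Orientation 𝓗
    D₀ E _ = increasing E
  ... | inj₂ Γ∈ with ∈-map⁻ (γ 𝓗 p) Γ∈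
  ...   | D , _ , eq = D , sym eq

------------------------------------------------------------------------
-- Non-negative real numbers

-- Dedekind cuts in the classical one-sided form: x is represented by
-- {q ∈ ℚ : q < x}.  Non-negativity of x says that all q < 0 belong.
record ℝ≥0 : Set₁ where
  field
    Below    : ℚ → Set
    negative : ∀ {q} → q < 0ℚ → Below q
    downward : ∀ {p q} → p < q → Below q → Below p
    open-up  : ∀ {q} → Below q → ∃ λ s → q < s × Below s
    bounded  : ∃ λ b → ¬ Below b

open ℝ≥0 public

infix 4 _≤ℝ_ _<ℝ_

_≤ℝ_ : ℝ≥0 → ℝ≥0 → Set
x ≤ℝ y = ∀ q → Below x q → Below y q

_<ℝ_ : ℝ≥0 → ℝ≥0 → Set
x <ℝ y = ∃ λ q → ¬ Below x q × Below y q

-- The supremum, in [0,∞), of a bounded set of rationals; in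
-- particular, the supremum of the empty set is 0.
sup : (A : ℚ → Set) → (∃ λ b → 0ℚ ≤ b × (∀ t → A t → t ≤ b)) → ℝ≥0
sup A (b , 0≤b , A≤b) = record
  { Below    = λ q → q < 0ℚ ⊎ (∃ λ t → A t × q < t)
  ; negative = inj₁
  ; downward = λ where
      p<q (inj₁ q<0)            → inj₁ (ℚₚ.<-trans p<q q<0)
      p<q (inj₂ (t , At , q<t)) → inj₂ (t , At , ℚₚ.<-trans p<q q<t)
  ; open-up  = λ where
      (inj₁ q<0) → let s , q<s , s<0 = ℚₚ.<-dense q<0 in s , q<s , inj₁ s<0
      (inj₂ (t , At , q<t)) →
        let s , q<s , s<t = ℚₚ.<-dense q<t in s , q<s , inj₂ (t , At , s<t)
  ; bounded  = b , λ where
      (inj₁ b<0)            → ℚₚ.<-irrefl refl (ℚₚ.<-≤-trans b<0 0≤b)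
      (inj₂ (t , At , b<t)) → ℚₚ.<-irrefl refl (ℚₚ.<-≤-trans b<t (A≤b t At))
  }

module _ (x : ℝ≥0) where

  below<bound : ∀ {b} → ¬ Below x b → ∀ {q} → Below x q → q < b
  below<bound {b} b∉x {q} q∈x with ℚₚ.<-cmp q b
  ... | tri< q<b _ _  = q<b
  ... | tri≈ _ refl _ = contradiction q∈x b∉x
  ... | tri> _ _ b<q  = contradiction (downward x b<q q∈x) b∉x

  bound≥0 : ∀ {b} → ¬ Below x b → 0ℚ ≤ b
  bound≥0 b∉x = ℚₚ.≮⇒≥ (b∉x ∘ negative x)

fromℕ : ℕ → ℝ≥0
fromℕ m = sup (_≡ + m / 1) (+ m / 1 , 0≤m , λ { _ refl → ℚₚ.≤-refl })
  where
  0≤m : 0ℚ ≤ + m / 1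
  0≤m = ℚₚ.nonNegative⁻¹ _ {{ℚₚ.normalize-nonNeg m 1}}

infixl 7 _*ℝ_

_*ℝ_ : ℝ≥0 → ℝ≥0 → ℝ≥0
x *ℝ y = sup Products bound
  where
  Products : ℚ → Set
  Products t = ∃ λ a → ∃ λ b →
    (0ℚ ≤ a × Below x a) × (0ℚ ≤ b × Below y b) × t ≡ a * b

  bound : ∃ λ b → 0ℚ ≤ b × (∀ t → Products t → t ≤ b)
  bound with bounded x | bounded y
  ... | u , u∉x | v , v∉y = u * v , 0≤uv , below
    where
    instance
      _ = nonNegative (bound≥0 x u∉x)
      _ = nonNegative (bound≥0 y v∉y)
    0≤uv : 0ℚ ≤ u * v
    0≤uv = subst (_≤ u * v) (ℚₚ.*-zeroʳ u) (ℚₚ.*-monoˡ-≤-nonNeg u (bound≥0 y v∉y))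
    below : ∀ t → Products t → t ≤ u * v
    below _ (a , b , (0≤a , a∈x) , (0≤b , b∈y) , refl) = ℚₚ.≤-trans
      (ℚₚ.*-monoˡ-≤-nonNeg a {{nonNegative 0≤a}} (ℚₚ.<⇒≤ (below<bound y v∉y b∈y)))
      (ℚₚ.*-monoʳ-≤-nonNeg v (ℚₚ.<⇒≤ (below<bound x u∉x a∈x)))

1≤^ : ∀ {t} → 1ℚ ≤ t → ∀ k → 1ℚ ≤ t ^ℚ k
≤^suc : ∀ {t} → 1ℚ ≤ t → ∀ k → t ≤ t ^ℚ suc k

1≤^ 1≤t zero    = ℚₚ.≤-refl
1≤^ 1≤t (suc k) = ℚₚ.≤-trans 1≤t (≤^suc 1≤t k)

≤^suc {t} 1≤t k =
  subst (_≤ t ^ℚ suc k) (ℚₚ.*-identityʳ t)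
    (ℚₚ.*-monoˡ-≤-nonNeg t {{nonNegative (ℚₚ.≤-trans 0≤1 1≤t)}} (1≤^ 1≤t k))
  where
  0≤1 : 0ℚ ≤ 1ℚ
  0≤1 = ℚₚ.nonNegative⁻¹ 1ℚ

-- x ^ (1 / k)
root : (k : ℕ) .{{_ : NonZero k}} → ℝ≥0 → ℝ≥0
root (suc k) x = sup (λ t → 0ℚ ≤ t × Below x (t ^ℚ suc k)) bound
  where
  bound : ∃ λ b → 0ℚ ≤ b × (∀ t → 0ℚ ≤ t × Below x (t ^ℚ suc k) → t ≤ b)
  bound with bounded x
  ... | u , u∉x = 1ℚ + u , ℚₚ.≤-trans 0≤1 1≤1+u , below
    where
    0≤1 : 0ℚ ≤ 1ℚ
    0≤1 = ℚₚ.nonNegative⁻¹ 1ℚ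
    1≤1+u : 1ℚ ≤ 1ℚ + u
    1≤1+u = subst (_≤ 1ℚ + u) (ℚₚ.+-identityʳ 1ℚ) (ℚₚ.+-monoʳ-≤ 1ℚ (bound≥0 x u∉x))
    u≤1+u : u ≤ 1ℚ + u
    u≤1+u = subst (_≤ 1ℚ + u) (ℚₚ.+-identityˡ u) (ℚₚ.+-monoˡ-≤ u 0≤1)
    below : ∀ t → 0ℚ ≤ t × Below x (t ^ℚ suc k) → t ≤ 1ℚ + u
    below t (_ , tᵏ∈x) with ℚₚ.≤-total t 1ℚ
    ... | inj₁ t≤1 = ℚₚ.≤-trans t≤1 1≤1+u
    ... | inj₂ 1≤t = ℚₚ.≤-trans (≤^suc 1≤t k)
                       (ℚₚ.≤-trans (ℚₚ.<⇒≤ (below<bound x u∉x tᵏ∈x)) u≤1+u)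

-- 1 + t + t² / 2! + … + tᴺ / N!
expSum : ℕ → ℚ → ℚ
expSum zero    t = 1ℚ
expSum (suc N) t = expSum N t + t ^ℚ suc N * (_/_ (+ 1) (suc N !) {{suc N !≢0}})

-- For t ≥ 0 the partial sums increase to exp t, so `ExpBelow n t` says
-- exp t ≤ n.
ExpBelow : ℕ → ℚ → Set
ExpBelow n t = ∀ N → expSum N t ≤ + n / 1

-- The natural logarithm, as the inverse of exp: sup {t ≥ 0 : exp t ≤ n}
-- for n ≥ 1 (and the junk value 0 for n = 0).
ln : ℕ → ℝ≥0
ln n = sup (λ t → 0ℚ ≤ t × ExpBelow n t) (+ n / 1 , 0≤n , below)
  where
  0≤n : 0ℚ ≤ + n / 1
  0≤n = ℚₚ.nonNegative⁻¹ _ {{ℚₚ.normalize-nonNeg n 1}}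
  below : ∀ t → 0ℚ ≤ t × ExpBelow n t → t ≤ + n / 1
  below t (0≤t , e) = ℚₚ.≤-trans t≤1+t (e 1)
    where
    t≡ : t ^ℚ 1 * (+ 1 / 1) ≡ t
    t≡ = trans (ℚₚ.*-identityʳ (t * 1ℚ)) (ℚₚ.*-identityʳ t)
    t≤1+t : t ≤ expSum 1 t
    t≤1+t = subst (λ s → t ≤ 1ℚ + s) (sym t≡)
      (subst (_≤ 1ℚ + t) (ℚₚ.+-identityˡ t)
        (ℚₚ.+-monoˡ-≤ t (ℚₚ.nonNegative⁻¹ 1ℚ)))

nonZero-∸1 : ∀ {r} → r ℕ.≥ 2 → NonZero (r ∸ 1)
nonZero-∸1 r≥2 = ℕ.>-nonZero (ℕₚ.∸-monoˡ-≤ 1 r≥2)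

{-# OPTIONS --safe #-}

-- Orient each edge E by one random bit: list it increasingly or decreasingly.
-- If a set S does not contain u, then u is dominated by S only through an edge
-- {u} ∪ t with t ⊆ S whose last vertex is u, and for each such edge one value
-- of its bit prevents this.  For |S| = k at most K = k^(r-1) edges matter, so
-- u stays undominated with probability at least 2^-K, independently for
-- distinct u, as their edges differ.  By the union bound some orientation has
-- no dominating set of size k once n^k (1 - 2^-K)^(n-k) < 1, and n ≥ 2^(7K)
-- suffices.  The union bound is derandomized: the bits are fixed one by one
-- such that an upper bound for the expected number of dominating k-sets never
-- increases.

module Submission where

open import Defs
open import Data.Nat using (ℕ; _∸_; _≥_)
open import Data.Product using (Σ-syntax; _×_)

import Algebra.Bundles as Bundles
import Algebra.Properties.Semiring.Exp as Exp
open import Data.Bool as Bool using (Bool; true; false; if_then_else_)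
open import Data.Fin using (Fin; zero; suc; toℕ; fromℕ<; inject≤; opposite)
import Data.Fin.Properties as Finₚ
open import Data.Fin.Subset
  using (Subset; inside; outside; _∈_; _∉_; _⊆_; ∣_∣; ⊥; ⁅_⁆; _∪_)
open import Data.Fin.Subset.Properties
  using (∉⊥; x∈⁅x⁆; x∈⁅y⁆⇒x≡y; x∈p∪q⁻; x∈p∪q⁺; ⊆-antisym)
open import Data.Integer as ℤ using (+_)
import Data.Integer.Properties as ℤₚ
open import Data.List as List using (List; []; _∷_; _++_; filter; foldr; length; map; allFin)
import Data.List.Membership.DecPropositional as DecMembership
open import Data.List.Membership.Propositional
  using (find; lose) renaming (_∈_ to _∈ᴸ_; _∉_ to _∉ᴸ_)
open import Data.List.Membership.Propositional.Properties
  using (∈-filter⁺; ∈-filter⁻; ∈-map⁺; ∈-map⁻; ∈-++⁺ˡ; ∈-++⁺ʳ; ∈-allFin;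
         ∈-cartesianProductWith⁺; ∈-cartesianProductWith⁻)
import Data.List.Properties as Listₚ
open import Data.List.Relation.Unary.All as AllL using (All; []; _∷_)
import Data.List.Relation.Unary.All.Properties as AllLₚ
open import Data.List.Relation.Unary.AllPairs as AllPairsL using (AllPairs; []; _∷_)
import Data.List.Relation.Unary.AllPairs.Properties as AllPairsLₚ
open import Data.List.Relation.Unary.Any as AnyL using (Any; here; there)
import Data.List.Relation.Unary.Any.Properties as AnyLₚ
import Data.List.Relation.Unary.Unique.Propositional.Properties as UniqueLₚ
open import Data.Nat as ℕ using (zero; suc; z≤n; s≤s; _!)
import Data.Nat.Properties as ℕₚ
open import Data.Nat.Properties using (_!≢0)
import Data.Nat.Solver
open import Data.Product using (∃; _,_; proj₁; proj₂)
open import Data.Rational as ℚ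
  using (ℚ; 0ℚ; 1ℚ; ½; _/_; _+_; _*_; _-_; -_; _≤_; _<_; nonNegative; toℚᵘ)
import Data.Rational.Properties as ℚₚ
open import Data.Rational.Solver using (module +-*-Solver)
open import Data.Rational.Unnormalised as ℚᵘ using (mkℚᵘ; *≡*)
import Data.Rational.Unnormalised.Properties as ℚᵘₚ
open import Data.Sum using (_⊎_; inj₁; inj₂)
open import Data.Vec as Vec using (Vec; []; _∷_; lookup; tabulate; toList)
open import Data.Vec.Membership.Propositional using () renaming (_∈_ to _∈ⱽ_)
import Data.Vec.Membership.Propositional.Properties as ∈ⱽₚ
import Data.Vec.Properties as Vecₚ
import Data.Vec.Relation.Unary.All.Properties as AllVₚ
open import Data.Vec.Relation.Unary.Any as AnyV using (here; there)
import Data.Vec.Relation.Unary.Any.Properties as AnyVₚ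
import Data.Vec.Relation.Unary.Unique.Propositional.Properties as UniqueVₚ
open import Function using (_∘_)
open import Relation.Binary.Definitions using (DecidableEquality)
open import Relation.Binary.PropositionalEquality
  using (_≡_; _≢_; refl; sym; trans; cong; cong₂; subst; module ≡-Reasoning)
open import Relation.Nullary using (¬_; Dec; yes; no; does; ¬?; contradiction)
open import Relation.Nullary.Decidable using (_→-dec_; _×-dec_)

open Exp (Bundles.CommutativeRing.semiring ℚₚ.+-*-commutativeRing) using (^-assocʳ)
module ℕS = Data.Nat.Solver.+-*-Solver

-- Rational arithmetic

0≤1 : 0ℚ ≤ 1ℚ
0≤1 = ℚₚ.nonNegative⁻¹ 1ℚ

*-nonNeg : ∀ {p q} → 0ℚ ≤ p → 0ℚ ≤ q → 0ℚ ≤ p * q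
*-nonNeg {p} {q} 0≤p 0≤q =
  subst (_≤ p * q) (ℚₚ.*-zeroʳ p) (ℚₚ.*-monoˡ-≤-nonNeg p {{nonNegative 0≤p}} 0≤q)

*-mono-≤ : ∀ {p q r s} → 0ℚ ≤ p → 0ℚ ≤ s → p ≤ q → r ≤ s → p * r ≤ q * s
*-mono-≤ {p} {q} {r} {s} 0≤p 0≤s p≤q r≤s = ℚₚ.≤-trans
  (ℚₚ.*-monoˡ-≤-nonNeg p {{nonNegative 0≤p}} r≤s)
  (ℚₚ.*-monoʳ-≤-nonNeg s {{nonNegative 0≤s}} p≤q)

p≤q⇒0≤q-p : ∀ {p q} → p ≤ q → 0ℚ ≤ q - p
p≤q⇒0≤q-p {p} {q} p≤q = subst (_≤ q - p) (ℚₚ.+-inverseʳ p) (ℚₚ.+-monoˡ-≤ (- p) p≤q)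

0≤^ : ∀ {q} → 0ℚ ≤ q → ∀ k → 0ℚ ≤ q ^ℚ k
0≤^ 0≤q zero    = 0≤1
0≤^ 0≤q (suc k) = *-nonNeg 0≤q (0≤^ 0≤q k)

^-monoˡ-≤ : ∀ {p q} → 0ℚ ≤ p → p ≤ q → ∀ k → p ^ℚ k ≤ q ^ℚ k
^-monoˡ-≤ 0≤p p≤q zero    = ℚₚ.≤-refl
^-monoˡ-≤ 0≤p p≤q (suc k) =
  *-mono-≤ 0≤p (0≤^ (ℚₚ.≤-trans 0≤p p≤q) k) p≤q (^-monoˡ-≤ 0≤p p≤q k)

^-antiʳ-≤ : ∀ {q} → 0ℚ ≤ q → q ≤ 1ℚ → ∀ {m n} → m ℕ.≤ n → q ^ℚ n ≤ q ^ℚ m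
^-antiʳ-≤ 0≤q q≤1 {n = zero}  z≤n = ℚₚ.≤-refl
^-antiʳ-≤ 0≤q q≤1 {n = suc n} z≤n = *-mono-≤ 0≤q 0≤1 q≤1 (^-antiʳ-≤ 0≤q q≤1 {n = n} z≤n)
^-antiʳ-≤ {q} 0≤q q≤1 (s≤s m≤n)   = ℚₚ.*-monoˡ-≤-nonNeg q {{nonNegative 0≤q}} (^-antiʳ-≤ 0≤q q≤1 m≤n)

0≤½^ : ∀ m → 0ℚ ≤ ½ ^ℚ m
0≤½^ = 0≤^ (ℚₚ.nonNegative⁻¹ ½)

½^-anti : ∀ {m n} → m ℕ.≤ n → ½ ^ℚ n ≤ ½ ^ℚ m
½^-anti = ^-antiʳ-≤ (ℚₚ.nonNegative⁻¹ ½) (ℚₚ.≤ᵇ⇒≤ {½} {1ℚ} _)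

½^suc : ∀ m → ½ ^ℚ suc m + ½ ^ℚ suc m ≡ ½ ^ℚ m
½^suc m = trans (sym (ℚₚ.*-distribʳ-+ (½ ^ℚ m) ½ ½)) (ℚₚ.*-identityˡ (½ ^ℚ m))

½^-double : ∀ {m n} → m ℕ.< n → ½ ^ℚ n + ½ ^ℚ n ≤ ½ ^ℚ m
½^-double {m} m<n =
  subst (_ ≤_) (½^suc m) (ℚₚ.+-mono-≤ (½^-anti m<n) (½^-anti m<n))

-- The averaging step of the derandomization: if both were at least 1, then `p + q` would be at
-- least 2, hence above `r + r`.
half-sum<1 : ∀ {p q r} → p + q ≤ r + r → r < 1ℚ → p < 1ℚ ⊎ q < 1ℚ
half-sum<1 {p} {q} {r} p+q≤2r r<1 with p ℚₚ.<? 1ℚ | q ℚₚ.<? 1ℚ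
... | yes p<1 | _       = inj₁ p<1
... | no  _   | yes q<1 = inj₂ q<1
... | no  p≮1 | no  q≮1 = contradiction
  (ℚₚ.≤-<-trans (ℚₚ.≤-trans (ℚₚ.+-mono-≤ (ℚₚ.≮⇒≥ p≮1) (ℚₚ.≮⇒≥ q≮1)) p+q≤2r)
                (ℚₚ.+-mono-< r<1 r<1))
  (ℚₚ.<-irrefl refl)

ι : ℕ → ℚ
ι m = + m / 1

toℚᵘ-ι : ∀ m → toℚᵘ (ι m) ℚᵘ.≃ mkℚᵘ (+ m) 0
toℚᵘ-ι m = ℚₚ.toℚᵘ-fromℚᵘ (mkℚᵘ (+ m) 0)

ι-+ : ∀ m n → ι (m ℕ.+ n) ≡ ι m + ι n
ι-+ m n = ℚₚ.toℚᵘ-injective (begin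
  toℚᵘ (ι (m ℕ.+ n))               ≈⟨ toℚᵘ-ι (m ℕ.+ n) ⟩
  mkℚᵘ (+ (m ℕ.+ n)) 0             ≈⟨ *≡* (cong (ℤ._* + 1) (sym (cong₂ ℤ._+_ (ℤₚ.*-identityʳ (+ m)) (ℤₚ.*-identityʳ (+ n))))) ⟩
  mkℚᵘ (+ m) 0 ℚᵘ.+ mkℚᵘ (+ n) 0   ≈⟨ ℚᵘₚ.+-cong (toℚᵘ-ι m) (toℚᵘ-ι n) ⟨
  toℚᵘ (ι m) ℚᵘ.+ toℚᵘ (ι n)       ≈⟨ ℚₚ.toℚᵘ-homo-+ (ι m) (ι n) ⟨
  toℚᵘ (ι m + ι n)                 ∎)
  where open ℚᵘₚ.≃-Reasoning

ι-* : ∀ m n → ι (m ℕ.* n) ≡ ι m * ι n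
ι-* m n = ℚₚ.toℚᵘ-injective (begin
  toℚᵘ (ι (m ℕ.* n))               ≈⟨ toℚᵘ-ι (m ℕ.* n) ⟩
  mkℚᵘ (+ (m ℕ.* n)) 0             ≈⟨ *≡* (cong (ℤ._* + 1) (ℤₚ.pos-* m n)) ⟩
  mkℚᵘ (+ m) 0 ℚᵘ.* mkℚᵘ (+ n) 0   ≈⟨ ℚᵘₚ.*-cong (toℚᵘ-ι m) (toℚᵘ-ι n) ⟨
  toℚᵘ (ι m) ℚᵘ.* toℚᵘ (ι n)       ≈⟨ ℚₚ.toℚᵘ-homo-* (ι m) (ι n) ⟨
  toℚᵘ (ι m * ι n)                 ∎)
  where open ℚᵘₚ.≃-Reasoning

ι-^ : ∀ m k → ι (m ℕ.^ k) ≡ ι m ^ℚ k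
ι-^ m zero    = refl
ι-^ m (suc k) = trans (ι-* m (m ℕ.^ k)) (cong (ι m *_) (ι-^ m k))

0≤ι : ∀ m → 0ℚ ≤ ι m
0≤ι m = ℚₚ.nonNegative⁻¹ _ {{ℚₚ.normalize-nonNeg m 1}}

ι-mono-≤ : ∀ {m n} → m ℕ.≤ n → ι m ≤ ι n
ι-mono-≤ {m} {n} m≤n = begin
  ι m               ≡⟨ ℚₚ.+-identityʳ (ι m) ⟨
  ι m + 0ℚ          ≤⟨ ℚₚ.+-monoʳ-≤ (ι m) (0≤ι (n ∸ m)) ⟩
  ι m + ι (n ∸ m)   ≡⟨ ι-+ m (n ∸ m) ⟨
  ι (m ℕ.+ (n ∸ m)) ≡⟨ cong ι (ℕₚ.m+[n∸m]≡n m≤n) ⟩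
  ι n               ∎
  where open ℚₚ.≤-Reasoning

ι-mono-< : ∀ {m n} → m ℕ.< n → ι m < ι n
ι-mono-< {m} {n} m<n = begin-strict
  ι m          ≡⟨ ℚₚ.+-identityˡ (ι m) ⟨
  0ℚ + ι m     <⟨ ℚₚ.+-monoˡ-< (ι m) (ℚₚ.positive⁻¹ 1ℚ) ⟩
  1ℚ + ι m     ≡⟨ ι-+ 1 m ⟨
  ι (suc m)    ≤⟨ ι-mono-≤ m<n ⟩
  ι n          ∎
  where open ℚₚ.≤-Reasoning

ι-cancel-≤ : ∀ {m n} → ι m ≤ ι n → m ℕ.≤ n
ι-cancel-≤ ιm≤ιn = ℕₚ.≮⇒≥ λ n<m → ℚₚ.<-irrefl refl (ℚₚ.≤-<-trans ιm≤ιn (ι-mono-< n<m))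

½^*2^ : ∀ m → ½ ^ℚ m * ι (2 ℕ.^ m) ≡ 1ℚ
½^*2^ zero    = refl
½^*2^ (suc m) = begin
  ½ * h * ι (2 ℕ.^ suc m)        ≡⟨ cong (½ * h *_) (ι-* 2 (2 ℕ.^ m)) ⟩
  ½ * h * (ι 2 * ι (2 ℕ.^ m))    ≡⟨ solve 2 (λ h t → con ½ :* h :* (con (ι 2) :* t) := h :* t) refl h (ι (2 ℕ.^ m)) ⟩
  h * ι (2 ℕ.^ m)                ≡⟨ ½^*2^ m ⟩
  1ℚ                             ∎
  where
  open ≡-Reasoning
  open +-*-Solver
  h = ½ ^ℚ m

-- A substitute for (1 - x)^m ≤ exp(-mx) that stays within ℚ. Induction on m, since (1 - x)(1 + (m +
-- 1)x) = 1 + mx - (m + 1)x² ≤ 1 + mx.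
reverse-bernoulli : ∀ {x} → 0ℚ ≤ x → x ≤ 1ℚ → ∀ m → (1ℚ - x) ^ℚ m * (1ℚ + ι m * x) ≤ 1ℚ
reverse-bernoulli {x} 0≤x x≤1 zero = ℚₚ.≤-reflexive
  (solve 1 (λ x → con 1ℚ :* (con 1ℚ :+ con 0ℚ :* x) := con 1ℚ) refl x)
  where open +-*-Solver
reverse-bernoulli {x} 0≤x x≤1 (suc m) = begin
  y * Y * (1ℚ + ι (suc m) * x)       ≡⟨ cong (λ i → y * Y * (1ℚ + i * x)) (ι-+ 1 m) ⟩
  y * Y * (1ℚ + (1ℚ + ι m) * x)      ≡⟨ solve 3 (λ x Y i →
    (con 1ℚ :- x) :* Y :* (con 1ℚ :+ (con 1ℚ :+ i) :* x) :=
    Y :* ((con 1ℚ :+ i :* x) :- (con 1ℚ :+ i) :* (x :* x))) refl x Y (ι m) ⟩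
  Y * ((1ℚ + ι m * x) - (1ℚ + ι m) * (x * x))
                                     ≤⟨ ℚₚ.*-monoˡ-≤-nonNeg Y {{nonNegative 0≤Y}} smaller ⟩
  Y * (1ℚ + ι m * x)                 ≤⟨ reverse-bernoulli 0≤x x≤1 m ⟩
  1ℚ                                 ∎
  where
  open ℚₚ.≤-Reasoning
  open +-*-Solver
  y Y : ℚ
  y = 1ℚ - x
  Y = (1ℚ - x) ^ℚ m
  0≤Y : 0ℚ ≤ Y
  0≤Y = 0≤^ (p≤q⇒0≤q-p x≤1) m
  smaller : (1ℚ + ι m * x) - (1ℚ + ι m) * (x * x) ≤ 1ℚ + ι m * x
  smaller = subst ((1ℚ + ι m * x) - (1ℚ + ι m) * (x * x) ≤_) (ℚₚ.+-identityʳ (1ℚ + ι m * x))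
    (ℚₚ.+-monoʳ-≤ (1ℚ + ι m * x) (ℚₚ.neg-antimono-≤
      (*-nonNeg (subst (0ℚ ≤_) (ι-+ 1 m) (0≤ι (suc m))) (*-nonNeg 0≤x 0≤x))))

module _ (K : ℕ) where

  private
    y : ℚ
    y = 1ℚ - ½ ^ℚ K
    0≤y : 0ℚ ≤ y
    0≤y = p≤q⇒0≤q-p (½^-anti {n = K} z≤n)
    y≤1 : y ≤ 1ℚ
    y≤1 = subst (y ≤_) (ℚₚ.+-identityʳ 1ℚ) (ℚₚ.+-monoʳ-≤ 1ℚ (ℚₚ.neg-antimono-≤ (0≤½^ K)))

  [1-½^K]^[2^K]≤½ : (1ℚ - ½ ^ℚ K) ^ℚ (2 ℕ.^ K) ≤ ½
  [1-½^K]^[2^K]≤½ = begin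
    Y                                     ≡⟨ solve 1 (λ Y → Y := Y :* (con 1ℚ :+ con 1ℚ) :* con ½) refl Y ⟩
    -- For x = 2^-K and m = 2^K the factor 1 + mx of `reverse-bernoulli` is 2.
    Y * (1ℚ + 1ℚ) * ½                     ≡⟨ cong (λ t → Y * (1ℚ + t) * ½) (trans (sym (½^*2^ K)) (ℚₚ.*-comm (½ ^ℚ K) _)) ⟩
    Y * (1ℚ + ι (2 ℕ.^ K) * ½ ^ℚ K) * ½   ≤⟨ ℚₚ.*-monoʳ-≤-nonNeg ½ (reverse-bernoulli (0≤½^ K) (½^-anti {n = K} z≤n) (2 ℕ.^ K)) ⟩
    1ℚ * ½                                ≡⟨⟩
    ½                                     ∎
    where
    open ℚₚ.≤-Reasoning
    open +-*-Solver
    Y : ℚ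
    Y = y ^ℚ (2 ℕ.^ K)

  [1-½^K]^N≤½^j : ∀ {j N} → 2 ℕ.^ K ℕ.* j ℕ.≤ N → (1ℚ - ½ ^ℚ K) ^ℚ N ≤ ½ ^ℚ j
  [1-½^K]^N≤½^j {j} {N} 2^Kj≤N = begin
    y ^ℚ N                      ≤⟨ ^-antiʳ-≤ 0≤y y≤1 2^Kj≤N ⟩
    y ^ℚ (2 ℕ.^ K ℕ.* j)        ≡⟨ ^-assocʳ y (2 ℕ.^ K) j ⟨
    (y ^ℚ (2 ℕ.^ K)) ^ℚ j       ≤⟨ ^-monoˡ-≤ (0≤^ 0≤y (2 ℕ.^ K)) [1-½^K]^[2^K]≤½ j ⟩
    ½ ^ℚ j                      ∎
    where open ℚₚ.≤-Reasoning

-- Growth estimates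

n!≤n^n : ∀ n → n ! ℕ.≤ n ℕ.^ n
n!≤n^n n = below n ℕₚ.≤-refl
  where
  below : ∀ m → m ℕ.≤ n → m ! ℕ.≤ n ℕ.^ m
  below zero    _   = ℕₚ.≤-refl
  below (suc m) m<n = ℕₚ.*-mono-≤ m<n (below m (ℕₚ.<⇒≤ m<n))

^-distribʳ-* : ∀ m n k → (m ℕ.* n) ℕ.^ k ≡ m ℕ.^ k ℕ.* n ℕ.^ k
^-distribʳ-* m n zero    = refl
^-distribʳ-* m n (suc k) = trans (cong (m ℕ.* n ℕ.*_) (^-distribʳ-* m n k))
  (ℕₚ.[m*n]*[o*p]≡[m*o]*[n*p] m n (m ℕ.^ k) (n ℕ.^ k))

1/m*m≡1 : ∀ m .{{_ : ℕ.NonZero m}} → (+ 1 / m) * ι m ≡ 1ℚ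
1/m*m≡1 (suc m) = ℚₚ.toℚᵘ-injective (begin
  toℚᵘ (+ 1 / suc m * ι (suc m))              ≈⟨ ℚₚ.toℚᵘ-homo-* (+ 1 / suc m) (ι (suc m)) ⟩
  toℚᵘ (+ 1 / suc m) ℚᵘ.* toℚᵘ (ι (suc m))    ≈⟨ ℚᵘₚ.*-cong (ℚₚ.toℚᵘ-fromℚᵘ (mkℚᵘ (+ 1) m)) (toℚᵘ-ι (suc m)) ⟩
  mkℚᵘ (+ 1) m ℚᵘ.* mkℚᵘ (+ suc m) 0          ≈⟨ *≡* (cong (λ t → + suc t) (trans (ℕₚ.*-identityʳ _) (trans (ℕₚ.+-identityʳ m) (sym (trans (ℕₚ.+-identityʳ _) (ℕₚ.*-identityʳ m)))))) ⟩
  toℚᵘ 1ℚ                                     ∎)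
  where open ℚᵘₚ.≃-Reasoning

0≤1/m : ∀ m .{{_ : ℕ.NonZero m}} → 0ℚ ≤ + 1 / m
0≤1/m m = ℚₚ.nonNegative⁻¹ _ {{ℚₚ.normalize-nonNeg 1 m}}

0≤expSum : ∀ {t} → 0ℚ ≤ t → ∀ N → 0ℚ ≤ expSum N t
0≤expSum 0≤t zero    = 0≤1
0≤expSum 0≤t (suc N) = ℚₚ.+-mono-≤ (0≤expSum 0≤t N)
  (*-nonNeg (0≤^ 0≤t (suc N)) (0≤1/m (suc N !) {{suc N !≢0}}))

-- The single term tᴺ / N! of the exponential series already suffices,
-- as N! ≤ Nᴺ.
2^N≤expSum : ∀ N {t} → ι (2 ℕ.* N) ≤ t → ι (2 ℕ.^ N) ≤ expSum N t
2^N≤expSum zero    _ = ℚₚ.≤-refl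
2^N≤expSum (suc N-1) {t} 2N≤t = begin
  ι (2 ℕ.^ N)                              ≡⟨ ℚₚ.*-identityʳ (ι (2 ℕ.^ N)) ⟨
  ι (2 ℕ.^ N) * 1ℚ                         ≡⟨ cong (ι (2 ℕ.^ N) *_) (trans (sym (1/m*m≡1 (N !) {{N !≢0}})) (ℚₚ.*-comm 1/N! (ι (N !)))) ⟩
  ι (2 ℕ.^ N) * (ι (N !) * 1/N!)           ≡⟨ ℚₚ.*-assoc (ι (2 ℕ.^ N)) (ι (N !)) 1/N! ⟨
  ι (2 ℕ.^ N) * ι (N !) * 1/N!             ≡⟨ cong (_* 1/N!) (ι-* (2 ℕ.^ N) (N !)) ⟨
  ι (2 ℕ.^ N ℕ.* N !) * 1/N!               ≤⟨ ℚₚ.*-monoʳ-≤-nonNeg 1/N! {{nonNegative 0≤1/N!}} (ι-mono-≤ (ℕₚ.*-monoʳ-≤ (2 ℕ.^ N) (n!≤n^n N))) ⟩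
  ι (2 ℕ.^ N ℕ.* N ℕ.^ N) * 1/N!           ≡⟨ cong (λ m → ι m * 1/N!) (^-distribʳ-* 2 N N) ⟨
  ι ((2 ℕ.* N) ℕ.^ N) * 1/N!               ≡⟨ cong (_* 1/N!) (ι-^ (2 ℕ.* N) N) ⟩
  ι (2 ℕ.* N) ^ℚ N * 1/N!                  ≤⟨ ℚₚ.*-monoʳ-≤-nonNeg 1/N! {{nonNegative 0≤1/N!}} (^-monoˡ-≤ (0≤ι (2 ℕ.* N)) 2N≤t N) ⟩
  t ^ℚ N * 1/N!                            ≡⟨ ℚₚ.+-identityˡ _ ⟨
  0ℚ + t ^ℚ N * 1/N!                       ≤⟨ ℚₚ.+-monoˡ-≤ (t ^ℚ N * 1/N!) (0≤expSum (ℚₚ.≤-trans (0≤ι (2 ℕ.* N)) 2N≤t) N-1) ⟩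
  expSum N t                               ∎
  where
  open ℚₚ.≤-Reasoning
  N : ℕ
  N = suc N-1
  1/N! : ℚ
  1/N! = _/_ (+ 1) (N !) {{N !≢0}}
  0≤1/N! : 0ℚ ≤ 1/N!
  0≤1/N! = 0≤1/m (N !) {{N !≢0}}

2^n<2^[1+n] : ∀ n → 2 ℕ.^ n ℕ.< 2 ℕ.^ suc n
2^n<2^[1+n] n = ℕₚ.^-monoʳ-< 2 (s≤s (s≤s z≤n)) (ℕₚ.n<1+n n)

binary-magnitude : ∀ n .{{_ : ℕ.NonZero n}} → ∃ λ a → 2 ℕ.^ a ℕ.≤ n × n ℕ.< 2 ℕ.^ suc a
binary-magnitude (suc zero)    = 0 , s≤s z≤n , s≤s (s≤s z≤n)
binary-magnitude (suc (suc n)) with binary-magnitude (suc n)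
... | a , lo , hi with suc (suc n) ℕ.<? 2 ℕ.^ suc a
...   | yes n<  = a , ℕₚ.m≤n⇒m≤1+n lo , n<
...   | no  n≮  = suc a , ℕₚ.≮⇒≥ n≮ , ℕₚ.<-≤-trans (s≤s hi) (2^n<2^[1+n] (suc a))

2^-cancel-< : ∀ {m n} → 2 ℕ.^ m ℕ.< 2 ℕ.^ n → m ℕ.< n
2^-cancel-< {m} {n} lt = ℕₚ.≰⇒> λ n≤m → ℕₚ.<⇒≱ lt (ℕₚ.^-monoʳ-≤ 2 n≤m)

n<2^n : ∀ n → n ℕ.< 2 ℕ.^ n
n<2^n zero    = s≤s z≤n
n<2^n (suc n) = ℕₚ.<-≤-trans (s≤s (n<2^n n)) (2^n<2^[1+n] n)

2n≤2^n : ∀ n → 2 ℕ.* n ℕ.≤ 2 ℕ.^ n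
2n≤2^n zero    = z≤n
2n≤2^n (suc n) = ℕₚ.*-monoʳ-≤ 2 (n<2^n n)

-- Supplies the two inequalities of the union bound. With 2^a ≤ n < 2^(a+1) it suffices that 2^K · K
-- · (a + 3) ≤ 2^a; here 2^(2K) absorbs 2^K · K, and a + 3 ≤ 2^(a - 2K) follows from 7K ≤ a.
enough-vertices : ∀ {k K n} → k ℕ.≤ K → 2 ℕ.^ (7 ℕ.* K) ℕ.≤ n → ∃ λ j →
                  n ℕ.^ k ℕ.< 2 ℕ.^ j × 2 ℕ.^ K ℕ.* j ℕ.≤ n ∸ k
enough-vertices {k} {zero} {n} z≤n 1≤n = 1 , s≤s (s≤s z≤n) , 1≤n
enough-vertices {k} {K@(suc K-1)} {n} k≤K 2^7K≤n
  with binary-magnitude n {{ℕ.>-nonZero (ℕₚ.<-≤-trans (ℕₚ.m^n>0 2 (7 ℕ.* K)) 2^7K≤n)}}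
... | a , 2^a≤n , n<2^1+a = j , n^k<2^j , ℕₚ.m+n≤o⇒m≤o∸n (2 ℕ.^ K ℕ.* j) (ℕₚ.≤-trans room 2^a≤n)
  where
  open ℕₚ.≤-Reasoning
  j d : ℕ
  -- The leading `suc` makes n^k ≤ 2^((a+1)k) < 2^j strict; 2^d is what remains of 2^a after the
  -- factor 2^(2K).
  j = suc (suc a ℕ.* k)
  d = a ∸ 2 ℕ.* K
  n^k<2^j : n ℕ.^ k ℕ.< 2 ℕ.^ j
  n^k<2^j = begin-strict
    n ℕ.^ k                ≤⟨ ℕₚ.^-monoˡ-≤ k (ℕₚ.<⇒≤ n<2^1+a) ⟩
    (2 ℕ.^ suc a) ℕ.^ k    ≡⟨ ℕₚ.^-*-assoc 2 (suc a) k ⟩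
    2 ℕ.^ (suc a ℕ.* k)    <⟨ 2^n<2^[1+n] (suc a ℕ.* k) ⟩
    2 ℕ.^ j                ∎
  7K≤a : 7 ℕ.* K ℕ.≤ a
  7K≤a = ℕₚ.≤-pred (2^-cancel-< {7 ℕ.* K} {suc a} (ℕₚ.≤-<-trans 2^7K≤n n<2^1+a))
  a≡ : 2 ℕ.* K ℕ.+ d ≡ a
  a≡ = ℕₚ.m+[n∸m]≡n (ℕₚ.≤-trans (ℕₚ.*-monoˡ-≤ K {2} {7} (s≤s (s≤s z≤n))) 7K≤a)
  5K≤d : 5 ℕ.* K ℕ.≤ d
  5K≤d = ℕₚ.+-cancelˡ-≤ (2 ℕ.* K) _ _ (begin
    2 ℕ.* K ℕ.+ 5 ℕ.* K   ≡⟨ ℕₚ.*-distribʳ-+ K 2 5 ⟨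
    7 ℕ.* K               ≤⟨ 7K≤a ⟩
    a                     ≡⟨ a≡ ⟨
    2 ℕ.* K ℕ.+ d         ∎)
  -- The origin of the 7: since 3 ≤ 3K, a + 3 is at most 5K + d, and 5K ≤ d holds once a ≥ 2K + 5K.
  a+3≤2^d : a ℕ.+ 3 ℕ.≤ 2 ℕ.^ d
  a+3≤2^d = begin
    a ℕ.+ 3                     ≡⟨ cong (ℕ._+ 3) a≡ ⟨
    2 ℕ.* K ℕ.+ d ℕ.+ 3         ≤⟨ ℕₚ.+-monoʳ-≤ (2 ℕ.* K ℕ.+ d) (ℕₚ.*-monoʳ-≤ 3 {1} {K} (s≤s z≤n)) ⟩
    2 ℕ.* K ℕ.+ d ℕ.+ 3 ℕ.* K   ≡⟨ ℕS.solve 2 (λ K d → ℕS.con 2 ℕS.:* K ℕS.:+ d ℕS.:+ ℕS.con 3 ℕS.:* K ℕS.:= ℕS.con 5 ℕS.:* K ℕS.:+ d) refl K d ⟩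
    5 ℕ.* K ℕ.+ d               ≤⟨ ℕₚ.+-monoˡ-≤ d 5K≤d ⟩
    d ℕ.+ d                     ≡⟨ cong (d ℕ.+_) (ℕₚ.+-identityʳ d) ⟨
    2 ℕ.* d                     ≤⟨ 2n≤2^n d ⟩
    2 ℕ.^ d                     ∎
  room : 2 ℕ.^ K ℕ.* j ℕ.+ k ℕ.≤ 2 ℕ.^ a
  room = begin
    T ℕ.* j ℕ.+ k                        ≤⟨ ℕₚ.+-mono-≤ (ℕₚ.*-monoʳ-≤ T (s≤s (ℕₚ.*-monoʳ-≤ (suc a) k≤K))) k≤K ⟩
    T ℕ.* suc (suc a ℕ.* K) ℕ.+ K        ≤⟨ ℕₚ.+-mono-≤ (ℕₚ.*-monoʳ-≤ T (ℕₚ.+-monoˡ-≤ (suc a ℕ.* K) {1} {K} (s≤s z≤n))) (ℕₚ.m≤n*m K T {{ℕₚ.m^n≢0 2 K}}) ⟩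
    T ℕ.* (K ℕ.+ suc a ℕ.* K) ℕ.+ T ℕ.* K  ≡⟨ ℕS.solve 3 (λ T a K → T ℕS.:* (K ℕS.:+ (K ℕS.:+ a ℕS.:* K)) ℕS.:+ T ℕS.:* K ℕS.:= T ℕS.:* K ℕS.:* (a ℕS.:+ ℕS.con 3)) refl T a K ⟩
    T ℕ.* K ℕ.* (a ℕ.+ 3)                ≤⟨ ℕₚ.*-mono-≤ (ℕₚ.*-monoʳ-≤ T (ℕₚ.<⇒≤ (n<2^n K))) a+3≤2^d ⟩
    T ℕ.* T ℕ.* 2 ℕ.^ d                  ≡⟨ cong (ℕ._* 2 ℕ.^ d) (trans (sym (ℕₚ.^-distribˡ-+-* 2 K K)) (cong (2 ℕ.^_) (cong (K ℕ.+_) (sym (ℕₚ.+-identityʳ K))))) ⟩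
    2 ℕ.^ (2 ℕ.* K) ℕ.* 2 ℕ.^ d          ≡⟨ ℕₚ.^-distribˡ-+-* 2 (2 ℕ.* K) d ⟨
    2 ℕ.^ (2 ℕ.* K ℕ.+ d)                ≡⟨ cong (2 ℕ.^_) a≡ ⟩
    2 ℕ.^ a                              ∎
    where
    T : ℕ
    T = 2 ℕ.^ K

-- Derandomization

module Derandomization {X : Set} (_≟_ : DecidableEquality X) where

  open DecMembership _≟_ using () renaming (_∈?_ to _∈ᴸ?_)

  -- A conjunction of literals, one for each x in `support`, asking for the value `target x`. As
  -- `target` is total, fixing a variable changes the support alone.
  record Term : Set where
    constructor mkTerm
    field
      target  : X → Bool
      support : List X

  open Term public

  -- The terms of the list form a disjunction; a list of such formulas, `F` below, stands for their
  -- conjunction.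
  DNF : Set
  DNF = List Term

  Satisfied : (X → Bool) → Term → Set
  Satisfied a t = All (λ x → a x ≡ target t x) (support t)

  Disjoint : Term → Term → Set
  Disjoint t u = ∀ {x} → x ∈ᴸ support t → x ∉ᴸ support u

  Within : List X → Term → Set
  Within xs t = ∀ {x} → x ∈ᴸ support t → x ∈ᴸ xs

  -- The probability that a uniformly random assignment falsifies t, if
  -- `support t` has no repetitions; an upper bound for it otherwise.
  failure : Term → ℚ
  failure t = 1ℚ - ½ ^ℚ length (support t)

  -- Disjoint terms fail independently, so for them this product bounds the probability that no term
  -- holds.
  failures : DNF → ℚ
  failures = foldr (λ t → failure t *_) 1ℚ

  -- The union bound for the event that some formula of the list is false.
  total : List DNF → ℚ
  total = foldr (λ D q → failures D + q) 0ℚ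

  Compatible : X → Bool → Term → Set
  Compatible x b t = x ∈ᴸ support t → target t x ≡ b

  compatible? : ∀ x b t → Dec (Compatible x b t)
  compatible? x b t = (x ∈ᴸ? support t) →-dec (target t x Bool.≟ b)

  ≢? : ∀ x y → Dec (y ≢ x)
  ≢? x y = ¬? (y ≟ x)

  without : X → Term → Term
  without x t = record t { support = filter (≢? x) (support t) }

  -- What remains once x is set to b: terms asking for the other value are false and disappear, the
  -- others lose every copy of x.
  restrict : X → Bool → DNF → DNF
  restrict x b D = map (without x) (filter (compatible? x b) D)

  restrict-keep : ∀ {x b t} D → Compatible x b t →
                  restrict x b (t ∷ D) ≡ without x t ∷ restrict x b D
  restrict-keep {x} {b} D c = cong (map (without x)) (Listₚ.filter-accept (compatible? x b) c)

  restrict-drop : ∀ {x b t} D → ¬ Compatible x b t → restrict x b (t ∷ D) ≡ restrict x b D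
  restrict-drop {x} {b} D ¬c = cong (map (without x)) (Listₚ.filter-reject (compatible? x b) ¬c)

  0≤failure : ∀ t → 0ℚ ≤ failure t
  0≤failure t = p≤q⇒0≤q-p (½^-anti {n = length (support t)} z≤n)

  0≤failures : ∀ D → 0ℚ ≤ failures D
  0≤failures []      = 0≤1
  0≤failures (t ∷ D) = *-nonNeg (0≤failure t) (0≤failures D)

  ∉⇒All≢ : ∀ {x : X} xs → x ∉ᴸ xs → All (_≢ x) xs
  ∉⇒All≢ xs x∉xs = AllL.tabulate λ y∈xs y≡x → x∉xs (subst (_∈ᴸ xs) y≡x y∈xs)

  failure-without-∉ : ∀ {x} t → x ∉ᴸ support t → failure (without x t) ≡ failure t
  failure-without-∉ {x} t x∉t =
    cong (λ xs → 1ℚ - ½ ^ℚ length xs) (Listₚ.filter-all (≢? x) (∉⇒All≢ (support t) x∉t))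

  -- One value of x falsifies t for certain, the other leaves `without x t`. Only an inequality,
  -- because x may be repeated in the support: removing all copies at least doubles the weight
  -- ½^length.
  failure-without-∈ : ∀ {x} t → x ∈ᴸ support t →
                      failure (without x t) + 1ℚ ≤ failure t + failure t
  failure-without-∈ {x} t x∈t = begin
    1ℚ - w′ + 1ℚ          ≡⟨ solve 1 (λ a → con 1ℚ :- a :+ con 1ℚ := con 1ℚ :+ con 1ℚ :- a) refl w′ ⟩
    1ℚ + 1ℚ - w′          ≤⟨ ℚₚ.+-monoʳ-≤ (1ℚ + 1ℚ) (ℚₚ.neg-antimono-≤ 2w≤w′) ⟩
    1ℚ + 1ℚ - (w + w)     ≡⟨ solve 1 (λ a → con 1ℚ :+ con 1ℚ :- (a :+ a) := (con 1ℚ :- a) :+ (con 1ℚ :- a)) refl w ⟩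
    (1ℚ - w) + (1ℚ - w)   ∎
    where
    open ℚₚ.≤-Reasoning
    open +-*-Solver
    w w′ : ℚ
    w  = ½ ^ℚ length (support t)
    w′ = ½ ^ℚ length (support (without x t))
    2w≤w′ : w + w ≤ w′
    2w≤w′ = ½^-double (Listₚ.filter-notAll (≢? x) (support t) (AnyL.map (λ x≡y y≢x → y≢x (sym x≡y)) x∈t))

  failures-restrict-∉ : ∀ {x} b D → All (λ t → x ∉ᴸ support t) D →
                        failures (restrict x b D) ≡ failures D
  failures-restrict-∉ b []      []          = refl
  failures-restrict-∉ {x} b (t ∷ D) (x∉t ∷ x∉D) =
    trans (cong failures (restrict-keep {x} {b} {t} D λ x∈t → contradiction x∈t x∉t))
          (cong₂ _*_ (failure-without-∉ t x∉t) (failures-restrict-∉ b D x∉D))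

  -- By disjointness at most one term contains x. If it is the head, one value of x leaves q′Q and
  -- the other Q, and q′ + 1 ≤ 2q. Otherwise q factors out of both sides and induction applies.
  failures-average : ∀ x D → AllPairs Disjoint D →
    failures (restrict x true D) + failures (restrict x false D) ≤ failures D + failures D
  failures-average x []      []             = ℚₚ.≤-refl
  failures-average x (t ∷ D) (t#D ∷ disjD) = by-membership (x ∈ᴸ? support t)
    where
    open ℚₚ.≤-Reasoning
    q′ q A B Q : ℚ
    q′ = failure (without x t)
    q  = failure t
    A  = failures (restrict x true D)
    B  = failures (restrict x false D)
    Q  = failures D
    Goal : Set
    Goal = failures (restrict x true (t ∷ D)) + failures (restrict x false (t ∷ D)) ≤ q * Q + q * Q

    unaffected : x ∉ᴸ support t → Goal
    unaffected x∉t = begin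
      failures (restrict x true (t ∷ D)) + failures (restrict x false (t ∷ D))
                      ≡⟨ cong₂ _+_ (cons true) (cons false) ⟩
      q * A + q * B   ≡⟨ ℚₚ.*-distribˡ-+ q A B ⟨
      q * (A + B)     ≤⟨ ℚₚ.*-monoˡ-≤-nonNeg q {{nonNegative (0≤failure t)}} (failures-average x D disjD) ⟩
      q * (Q + Q)     ≡⟨ ℚₚ.*-distribˡ-+ q Q Q ⟩
      q * Q + q * Q   ∎
      where
      cons : ∀ b → failures (restrict x b (t ∷ D)) ≡ q * failures (restrict x b D)
      cons b = trans (cong failures (restrict-keep {x} {b} {t} D λ x∈t → contradiction x∈t x∉t))
                     (cong (_* failures (restrict x b D)) (failure-without-∉ t x∉t))

    affected : x ∈ᴸ support t → Goal
    affected x∈t = go (target t x) refl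
      where
      x∉D : All (λ u → x ∉ᴸ support u) D
      x∉D = AllL.map (λ t#u → t#u x∈t) t#D
      keep : ∀ {b} → target t x ≡ b → failures (restrict x b (t ∷ D)) ≡ q′ * Q
      keep {b} eq = trans (cong failures (restrict-keep {x} {b} {t} D λ _ → eq))
                          (cong (q′ *_) (failures-restrict-∉ b D x∉D))
      drop : ∀ {b} → target t x ≢ b → failures (restrict x b (t ∷ D)) ≡ Q
      drop {b} neq = trans (cong failures (restrict-drop {x} {b} {t} D λ c → neq (c x∈t)))
                           (failures-restrict-∉ b D x∉D)
      bound : q′ * Q + Q ≤ q * Q + q * Q
      bound = begin
        q′ * Q + Q        ≡⟨ cong (λ q → q′ * Q + q) (ℚₚ.*-identityˡ Q) ⟨
        q′ * Q + 1ℚ * Q   ≡⟨ ℚₚ.*-distribʳ-+ Q q′ 1ℚ ⟨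
        (q′ + 1ℚ) * Q     ≤⟨ ℚₚ.*-monoʳ-≤-nonNeg Q {{nonNegative (0≤failures D)}} (failure-without-∈ t x∈t) ⟩
        (q + q) * Q       ≡⟨ ℚₚ.*-distribʳ-+ Q q q ⟩
        q * Q + q * Q     ∎
      go : ∀ b → target t x ≡ b → Goal
      go true eq = begin
        failures (restrict x true (t ∷ D)) + failures (restrict x false (t ∷ D))
                         ≡⟨ cong₂ _+_ (keep eq) (drop λ eq′ → contradiction (trans (sym eq) eq′) λ ()) ⟩
        q′ * Q + Q       ≤⟨ bound ⟩
        q * Q + q * Q    ∎
      go false eq = begin
        failures (restrict x true (t ∷ D)) + failures (restrict x false (t ∷ D))
                         ≡⟨ cong₂ _+_ (drop λ eq′ → contradiction (trans (sym eq) eq′) λ ()) (keep eq) ⟩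
        Q + q′ * Q       ≡⟨ ℚₚ.+-comm Q (q′ * Q) ⟩
        q′ * Q + Q       ≤⟨ bound ⟩
        q * Q + q * Q    ∎

    by-membership : Dec (x ∈ᴸ support t) → Goal
    by-membership (yes x∈t) = affected x∈t
    by-membership (no x∉t)  = unaffected x∉t

  total-average : ∀ x F → All (AllPairs Disjoint) F →
    total (map (restrict x true) F) + total (map (restrict x false) F) ≤ total F + total F
  total-average x []      []           = ℚₚ.≤-refl
  total-average x (D ∷ F) (disj ∷ disjF) = begin
    (a + A) + (b + B)   ≡⟨ interchange a A b B ⟩
    (a + b) + (A + B)   ≤⟨ ℚₚ.+-mono-≤ (failures-average x D disj) (total-average x F disjF) ⟩
    (d + d) + (T + T)   ≡⟨ interchange d d T T ⟩
    (d + T) + (d + T)   ∎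
    where
    open ℚₚ.≤-Reasoning
    a b d A B T : ℚ
    a = failures (restrict x true D)
    b = failures (restrict x false D)
    d = failures D
    A = total (map (restrict x true) F)
    B = total (map (restrict x false) F)
    T = total F
    interchange : ∀ p q r s → (p + q) + (r + s) ≡ (p + r) + (q + s)
    interchange = let open +-*-Solver in
      solve 4 (λ p q r s → (p :+ q) :+ (r :+ s) := (p :+ r) :+ (q :+ s)) refl

  restrict-disjoint : ∀ x b {D} → AllPairs Disjoint D → AllPairs Disjoint (restrict x b D)
  restrict-disjoint x b disj = AllPairsLₚ.map⁺
    (AllPairsL.map (λ {t} {u} → disjoint-without {t} {u})
      (AllPairsLₚ.filter⁺ (compatible? x b) disj))
    where
    disjoint-without : ∀ {t u} → Disjoint t u → Disjoint (without x t) (without x u)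
    disjoint-without t#u y∈t y∈u =
      t#u (proj₁ (∈-filter⁻ (≢? x) y∈t)) (proj₁ (∈-filter⁻ (≢? x) y∈u))

  restrict-within : ∀ x b {xs D} → All (Within (x ∷ xs)) D → All (Within xs) (restrict x b D)
  restrict-within x b {xs} in-xs = AllLₚ.map⁺
    (AllL.map (λ {t} → tail {t}) (AllLₚ.filter⁺ (compatible? x b) in-xs))
    where
    tail : ∀ {t} → Within (x ∷ xs) t → Within xs (without x t)
    tail in-t y∈ with ∈-filter⁻ (≢? x) y∈
    ... | y∈t , y≢x with in-t y∈t
    ...   | here y≡x   = contradiction y≡x y≢x
    ...   | there y∈xs = y∈xs

  _[_≔_] : (X → Bool) → X → Bool → X → Bool
  (a [ x ≔ b ]) y = if does (y ≟ x) then b else a y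

  -- At x the new value b is the target by compatibility; elsewhere the update changes nothing.
  satisfied-update : ∀ a x b {t} → Compatible x b t → Satisfied a (without x t) →
                     Satisfied (a [ x ≔ b ]) t
  satisfied-update a x b {t} comp sat = AllL.tabulate at
    where
    at : ∀ {y} → y ∈ᴸ support t → (a [ x ≔ b ]) y ≡ target t y
    at {y} y∈t with y ≟ x
    ... | yes refl = sym (comp y∈t)
    ... | no y≢x   = AllL.lookup sat (∈-filter⁺ (≢? x) y∈t y≢x)

  restrict-satisfied : ∀ a x b D → Any (Satisfied a) (restrict x b D) →
                       Any (Satisfied (a [ x ≔ b ])) D
  restrict-satisfied a x b D sat with find (AnyLₚ.map⁻ sat)
  ... | t , t∈ , sat-t with ∈-filter⁻ (compatible? x b) {xs = D} t∈
  ...   | t∈D , c = lose t∈D (satisfied-update a x b c sat-t)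

  0≤total : ∀ F → 0ℚ ≤ total F
  0≤total []      = ℚₚ.≤-refl
  0≤total (D ∷ F) = ℚₚ.+-mono-≤ (0≤failures D) (0≤total F)

  -- An empty disjunction would contribute the empty product 1 to `total`. So every formula has a
  -- first term, and with empty support it holds under any assignment.
  no-variables : ∀ a F → All (All (Within [])) F → total F < 1ℚ → All (Any (Satisfied a)) F
  no-variables a []      []           _   = []
  no-variables a ([] ∷ F) _           t<1 = contradiction
    (ℚₚ.≤-<-trans (ℚₚ.+-monoʳ-≤ 1ℚ (0≤total F)) t<1) (ℚₚ.<-irrefl refl)
  no-variables a ((t ∷ D) ∷ F) ((in-t ∷ _) ∷ in-F) total<1 =
    here (AllL.tabulate λ x∈t → contradiction (in-t x∈t) λ ()) ∷
    no-variables a F in-F (ℚₚ.≤-<-trans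
      (subst (_≤ total ((t ∷ D) ∷ F)) (ℚₚ.+-identityˡ (total F))
        (ℚₚ.+-monoˡ-≤ (total F) (0≤failures (t ∷ D)))) total<1)

  -- The method of conditional expectations: fix the variables one after
  -- the other without ever increasing `total`.
  satisfiable : ∀ xs F → All (All (Within xs)) F → All (AllPairs Disjoint) F → total F < 1ℚ →
                ∃ λ a → All (Any (Satisfied a)) F
  satisfiable []       F in-xs _    total<1 = (λ _ → true) , no-variables _ F in-xs total<1
  satisfiable (x ∷ xs) F in-xs disj total<1 = fix (half-sum<1 (total-average x F disj) total<1)
    where
    fix-to : ∀ b → total (map (restrict x b) F) < 1ℚ → ∃ λ a → All (Any (Satisfied a)) F
    fix-to b small with satisfiable xs (map (restrict x b) F)
                          (AllLₚ.map⁺ (AllL.map (restrict-within x b) in-xs))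
                          (AllLₚ.map⁺ (AllL.map (restrict-disjoint x b) disj)) small
    ... | a , sat = a [ x ≔ b ] , AllL.map (restrict-satisfied a x b _) (AllLₚ.map⁻ sat)
    fix : total (map (restrict x true) F) < 1ℚ ⊎ total (map (restrict x false) F) < 1ℚ →
          ∃ λ a → All (Any (Satisfied a)) F
    fix (inj₁ small) = fix-to true small
    fix (inj₂ small) = fix-to false small

-- Undominated vertices

private variable
  n m k p : ℕ

elements : Vec (Fin n) m → Subset n
elements []      = ⊥
elements (x ∷ v) = ⁅ x ⁆ ∪ elements v

∈-elements⁺ : ∀ {x : Fin n} {v : Vec (Fin n) m} → x ∈ⱽ v → x ∈ elements v
∈-elements⁺ {x = x} (here refl) = x∈p∪q⁺ (inj₁ (x∈⁅x⁆ x))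
∈-elements⁺ (there x∈v)         = x∈p∪q⁺ (inj₂ (∈-elements⁺ x∈v))

∈-elements⁻ : ∀ {x : Fin n} (v : Vec (Fin n) m) → x ∈ elements v → x ∈ⱽ v
∈-elements⁻ []      x∈ = contradiction x∈ ∉⊥
∈-elements⁻ (y ∷ v) x∈ with x∈p∪q⁻ ⁅ y ⁆ (elements v) x∈
... | inj₁ x∈y = here (x∈⁅y⁆⇒x≡y y x∈y)
... | inj₂ x∈v = there (∈-elements⁻ v x∈v)

∈-vecs⁺ : ∀ {A : Set} {xs : List A} (v : Vec A m) → (∀ {x} → x ∈ⱽ v → x ∈ᴸ xs) → v ∈ᴸ vecs xs m
∈-vecs⁺ []      _    = here refl
∈-vecs⁺ (x ∷ v) v⊆xs =
  ∈-cartesianProductWith⁺ _∷_ (v⊆xs (here refl)) (∈-vecs⁺ v (v⊆xs ∘ there))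

∈-vecs⁻ : ∀ {A : Set} {xs : List A} {v : Vec A m} → v ∈ᴸ vecs xs m → ∀ {x} → x ∈ⱽ v → x ∈ᴸ xs
∈-vecs⁻ {m = suc m} {xs = xs} v∈ x∈v
  with ∈-cartesianProductWith⁻ _∷_ xs (vecs xs m) v∈
∈-vecs⁻ {m = suc m} v∈ (here refl) | _ , _ , a∈xs , _ , refl = a∈xs
∈-vecs⁻ {m = suc m} v∈ (there x∈v) | _ , _ , _ , w∈ , refl   = ∈-vecs⁻ w∈ x∈v

length-vecs : ∀ {A : Set} (xs : List A) m → length (vecs xs m) ≡ length xs ℕ.^ m
length-vecs xs zero    = refl
length-vecs xs (suc m) = trans (length-product xs) (cong (length xs ℕ.*_) (length-vecs xs m))
  where
  length-product : ∀ ys → length (List.cartesianProductWith _∷_ ys (vecs xs m)) ≡ length ys ℕ.* length (vecs xs m)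
  length-product []       = refl
  length-product (y ∷ ys) = trans (Listₚ.length-++ (map (y ∷_) (vecs xs m)))
    (cong₂ ℕ._+_ (Listₚ.length-map (y ∷_) (vecs xs m)) (length-product ys))

-- Lets k-tuples stand for all sets of at most k vertices. A vertex kept undominated by the larger
-- set also escapes the smaller one.
pad : ∀ {A : Set} → m ℕ.≤ k → A → Vec A m → Vec A k
pad z≤n       a []      = Vec.replicate _ a
pad (s≤s m≤k) a (x ∷ v) = x ∷ pad m≤k a v

∈-pad : ∀ {A : Set} {a x : A} {v : Vec A m} (m≤k : m ℕ.≤ k) → x ∈ⱽ v → x ∈ⱽ pad m≤k a v
∈-pad (s≤s m≤k) (here refl) = here refl
∈-pad (s≤s m≤k) (there x∈v) = there (∈-pad m≤k x∈v)

-- Orientations given by one bit per edge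

module _ {n : ℕ} where

  -- True of every linear ordering by counting; here it is checked directly for the two orderings in
  -- use.
  Lists : {E : Subset n} → LinearOrdering E → Set
  Lists {E} o = ∀ {x} → x ∈ E → ∃ λ i → lookup (order o) i ≡ x

  reversed : (E : Subset n) → LinearOrdering E
  reversed E = mkOrdering
    (tabulate (lookup v ∘ opposite))
    (AllVₚ.tabulate⁺ (λ i → AllVₚ.lookup⁺ (within (increasing E)) (opposite i)))
    (UniqueVₚ.tabulate⁺ λ {i} {j} eq →
      trans (sym (Finₚ.opposite-involutive i))
        (trans (cong opposite (UniqueVₚ.lookup-injective (distinct (increasing E)) _ _ eq))
          (Finₚ.opposite-involutive j)))
    where
    v = order (increasing E)

∈-increasing : ∀ (E : Subset n) {x} → x ∈ E → x ∈ⱽ order (increasing E)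
∈-increasing (outside ∷ E) {suc x} (Vec.there x∈E) = ∈ⱽₚ.∈-map⁺ suc (∈-increasing E x∈E)
∈-increasing (inside  ∷ E) {zero}  Vec.here        = here refl
∈-increasing (inside  ∷ E) {suc x} (Vec.there x∈E) = there (∈ⱽₚ.∈-map⁺ suc (∈-increasing E x∈E))

module _ {n : ℕ} (E : Subset n) where

  increasing-lists : Lists (increasing E)
  increasing-lists x∈E = AnyV.index x∈ , sym (AnyVₚ.lookup-index x∈)
    where x∈ = ∈-increasing E x∈E

  lookup-reversed : ∀ i → lookup (order (reversed E)) (opposite i) ≡ lookup (order (increasing E)) i
  lookup-reversed i = trans (Vecₚ.lookup∘tabulate _ (opposite i))
    (cong (lookup (order (increasing E))) (Finₚ.opposite-involutive i))

  reversed-lists : Lists (reversed E)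
  reversed-lists x∈E with increasing-lists x∈E
  ... | i , eq = opposite i , trans (lookup-reversed i) eq

  -- Decides whether u is the least element of E. The position is an index of value 0, as
  -- `Fin ∣ E ∣` has no visible `zero`.
  isMin? : (u : Fin n) → Dec (∃ λ i → toℕ i ≡ 0 × lookup (order (increasing E)) i ≡ u)
  isMin? u = Finₚ.any? λ i → (toℕ i ℕ.≟ 0) ×-dec (lookup (order (increasing E)) i Finₚ.≟ u)

orient : ∀ {r} → (Subset n → Bool) → Orientation (H n r)
orient a E _ = if a E then increasing E else reversed E

orient-lists : ∀ (a : Subset n → Bool) E → Lists (if a E then increasing E else reversed E)
orient-lists a E with a E
... | true  = increasing-lists E
... | false = reversed-lists E

-- All vertices but the last lie in S, so u would have to be last. With this bit it is not: a least
-- u comes first in increasing order, and any other u precedes the least vertex in decreasing order.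
not-last : ∀ (a : Subset n → Bool) {E u S} → ∣ E ∣ ≡ suc (suc p) → u ∈ E → u ∉ S →
           a E ≡ does (isMin? E u) → ¬ FirstIn (suc p) (if a E then increasing E else reversed E) S
not-last a {E} {u} {S} ∣E∣≡r u∈E u∉S eq first with a E | isMin? E u
... | true  | yes (i , i≡0 , refl) = u∉S (first i (subst (ℕ._< suc _) (sym i≡0) (s≤s z≤n)))
... | false | no ¬min with increasing-lists E u∈E
...   | j , refl = u∉S (subst (_∈ S) (lookup-reversed E j) (first (opposite j) opposite-j<p))
  where
  opposite-j<p : toℕ (opposite j) ℕ.< suc _
  opposite-j<p with toℕ j in j≡
  ... | zero   = contradiction (j , j≡ , refl) ¬min
  -- The reversed position is (p + 2) - (j′ + 2) = p - j′.
  ... | suc j′ = s≤s (ℕₚ.≤-trans (ℕₚ.≤-reflexive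
    (trans (Finₚ.opposite-prop j) (cong₂ (λ r i → r ∸ suc i) ∣E∣≡r j≡))) (ℕₚ.m∸n≤m _ j′))

-- The first p vertices form t. As u is outside S, it occupies the only remaining position p, so E
-- is {u} ∪ t.
edge-shape : ∀ {E : Subset n} (o : LinearOrdering E) → Lists o → ∀ {u S} → ∣ E ∣ ≡ suc p →
             u ∈ E → u ∉ S → FirstIn p o S →
             ∃ λ (t : Vec (Fin n) p) → (∀ {x} → x ∈ⱽ t → x ∈ S) × elements (u ∷ t) ≡ E
edge-shape {n} {p} {E} o lists {u} {S} ∣E∣≡r u∈E u∉S first =
  t , t⊆S , ⊆-antisym to from
  where
  p≤∣E∣ : p ℕ.≤ ∣ E ∣
  p≤∣E∣ = subst (p ℕ.≤_) (sym ∣E∣≡r) (ℕₚ.n≤1+n p)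
  at : Fin p → Fin ∣ E ∣
  at i = inject≤ i p≤∣E∣
  t : Vec (Fin n) p
  t = tabulate (lookup (order o) ∘ at)
  ∈t⁻ : ∀ {x} → x ∈ⱽ t → ∃ λ i → x ≡ lookup (order o) (at i)
  ∈t⁻ x∈t = AnyV.index x∈t , trans (AnyVₚ.lookup-index x∈t) (Vecₚ.lookup∘tabulate _ (AnyV.index x∈t))
  t⊆S : ∀ {x} → x ∈ⱽ t → x ∈ S
  t⊆S x∈t with ∈t⁻ x∈t
  ... | i , refl = first (at i) (subst (ℕ._< p) (sym (Finₚ.toℕ-inject≤ i p≤∣E∣)) (Finₚ.toℕ<n i))
  last : ∀ i → ¬ toℕ i ℕ.< p → toℕ i ≡ p
  last i i≮p = ℕₚ.≤-antisym (ℕₚ.≤-pred (subst (toℕ i ℕ.<_) ∣E∣≡r (Finₚ.toℕ<n i))) (ℕₚ.≮⇒≥ i≮p)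
  to : elements (u ∷ t) ⊆ E
  to x∈ with ∈-elements⁻ (u ∷ t) x∈
  ... | here refl = u∈E
  ... | there x∈t with ∈t⁻ x∈t
  ...   | i , refl = AllVₚ.lookup⁺ (within o) (at i)
  from : E ⊆ elements (u ∷ t)
  from x∈E with lists x∈E | lists u∈E
  ... | i , refl | j , eq with toℕ i ℕ.<? p
  ...   | yes i<p = ∈-elements⁺ {v = u ∷ t} (there (subst (_∈ⱽ t) (cong (lookup (order o)) at≡i)
                      (∈ⱽₚ.∈-tabulate⁺ (lookup (order o) ∘ at) (fromℕ< i<p))))
    where
    at≡i : at (fromℕ< i<p) ≡ i
    at≡i = Finₚ.toℕ-injective (trans (Finₚ.toℕ-inject≤ _ p≤∣E∣) (Finₚ.toℕ-fromℕ< i<p))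
  ...   | no i≮p = ∈-elements⁺ {v = u ∷ t} (here (trans (cong (lookup (order o)) i≡j) eq))
    where
    j≮p : ¬ toℕ j ℕ.< p
    j≮p j<p = u∉S (subst (_∈ S) eq (first j j<p))
    i≡j : i ≡ j
    i≡j = Finₚ.toℕ-injective (trans (last i i≮p) (sym (last j j≮p)))

-- Formulas expressing that a set does not dominate

_≟ˢ_ : DecidableEquality (Subset n)
_≟ˢ_ = Vecₚ.≡-dec Bool._≟_

AllPairs-zip : ∀ {A : Set} {P : A → Set} {R : A → A → Set} {xs} →
               All P xs → AllPairs R xs → AllPairs (λ x y → P x × R x y) xs
AllPairs-zip []         []         = []
AllPairs-zip (px ∷ pxs) (rx ∷ rxs) = AllL.map (px ,_) rx ∷ AllPairs-zip pxs rxs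

module Formula (n p : ℕ) where

  open Derandomization (_≟ˢ_ {n})
  open DecMembership (Finₚ._≟_ {n}) using () renaming (_∈?_ to _∈ᴸ?_)

  -- Satisfied iff no edge {u} ∪ t with t drawn from s has u last: the least
  -- vertex of an edge is not last in increasing order (`true`), any other
  -- vertex not last in decreasing order.  Tuples t with repetitions give
  -- vertex sets that are not edges; their bits are constrained needlessly,
  -- which keeps the count at ∣s∣ᵖ and preserves disjointness.
  undominated : List (Fin n) → Fin n → Term
  undominated s u = mkTerm (λ E → does (isMin? E u)) (map (λ t → elements (u ∷ t)) (vecs s p))

  outsiders : List (Fin n) → List (Fin n)
  outsiders s = filter (λ u → ¬? (u ∈ᴸ? s)) (allFin n)

  undominating : List (Fin n) → DNF
  undominating s = map (undominated s) (outsiders s)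

  -- A common vertex set {u} ∪ t = {w} ∪ t′ would contain u, forcing u = w or u among the entries of
  -- t′, which come from s.
  undominated-disjoint : ∀ s {u w} → u ∉ᴸ s × u ≢ w → Disjoint (undominated s u) (undominated s w)
  undominated-disjoint s {u} {w} (u∉s , u≢w) E∈ E∈′
    with ∈-map⁻ _ E∈ | ∈-map⁻ _ E∈′
  ... | t , t∈ , refl | t′ , t′∈ , eq
    with ∈-elements⁻ (w ∷ t′) (subst (u ∈_) eq (∈-elements⁺ {v = u ∷ t} (here refl)))
  ... | here u≡w   = u≢w u≡w
  ... | there u∈t′ = u∉s (∈-vecs⁻ t′∈ u∈t′)

  undominating-disjoint : ∀ s → AllPairs Disjoint (undominating s)
  undominating-disjoint s = AllPairsLₚ.map⁺ (AllPairsL.map (λ {u} {w} → undominated-disjoint s {u} {w})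
    (AllPairs-zip (AllLₚ.all-filter (λ u → ¬? (u ∈ᴸ? s)) (allFin n))
      (AllPairsLₚ.filter⁺ (λ u → ¬? (u ∈ᴸ? s)) (UniqueLₚ.allFin⁺ n))))

  failures-undominating : ∀ s →
    failures (undominating s) ≡ (1ℚ - ½ ^ℚ (length s ℕ.^ p)) ^ℚ length (outsiders s)
  failures-undominating s = go (outsiders s)
    where
    go : ∀ us → failures (map (undominated s) us) ≡ (1ℚ - ½ ^ℚ (length s ℕ.^ p)) ^ℚ length us
    go []       = refl
    go (u ∷ us) = cong₂ (λ l q → (1ℚ - ½ ^ℚ l) * q)
      (trans (Listₚ.length-map _ (vecs s p)) (length-vecs s p)) (go us)

  -- Tuples instead of k-sets are easy to count, n^k in all; a tuple with repetitions just describes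
  -- a smaller set.
  all-undominating : ℕ → List DNF
  all-undominating k = map (undominating ∘ toList) (vecs (allFin n) k)

module _ {n p : ℕ} (k : ℕ) (v₀ : Fin n) where
  open Derandomization (_≟ˢ_ {n})
  open Formula n (suc p)
  open DecMembership (Finₚ._≟_ {n}) using () renaming (_∈?_ to _∈ᴸ?_)

  -- For the padded tuple s of S, the assignment satisfies the term of some u outside s. An edge
  -- dominating u would have the form {u} ∪ t with t from S, so its bit is fixed by that term and u
  -- is not last.
  small-sets-not-dominating : total (all-undominating k) < 1ℚ →
    ∃ λ (D : Orientation (H n (suc (suc p)))) →
      ∀ S → ∣ S ∣ ℕ.≤ k → ¬ Dominating (H n (suc (suc p))) (suc p) D S
  small-sets-not-dominating small with satisfiable (subsets n) (all-undominating k)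
       -- The variables are all vertex subsets, so every support lies within them.
       (AllL.universal (λ _ → AllL.universal (λ _ {E} _ → subsets-complete E) _) _)
       (AllLₚ.map⁺ (AllL.universal (λ v → undominating-disjoint (toList v)) _)) small
  ... | a , sat = orient a , not-dominating
    where
    not-dominating : ∀ S → ∣ S ∣ ℕ.≤ k → ¬ Dominating (H n (suc (suc p))) (suc p) (orient a) S
    not-dominating S ∣S∣≤k dom
      with find (AnyLₚ.map⁻ (AllL.lookup (AllLₚ.map⁻ sat)
             (vecs-complete ∈-allFin (pad ∣S∣≤k v₀ (order (increasing S))))))
    ... | u , u∈ , sat-u = go (dom u u∉S)
      where
      s : List (Fin n)
      s = toList (pad ∣S∣≤k v₀ (order (increasing S)))
      S⊆s : ∀ {x} → x ∈ S → x ∈ᴸ s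
      S⊆s x∈S = ∈ⱽₚ.∈-toList⁺ (∈-pad ∣S∣≤k (∈-increasing S x∈S))
      u∉S : u ∉ S
      u∉S u∈S = proj₂ (∈-filter⁻ (λ u → ¬? (u ∈ᴸ? s)) {xs = allFin n} u∈) (S⊆s u∈S)
      go : ¬ ∃ λ E → Σ[ e ∈ Edge (H n (suc (suc p))) E ] (u ∈ E × FirstIn (suc p) (orient {r = suc (suc p)} a E e) S)
      go (E , e , u∈E , first) with edge-shape (if a E then increasing E else reversed E) (orient-lists a E) e u∈E u∉S first
      ... | t , t⊆S , refl = not-last a e u∈E u∉S
            (AllL.lookup sat-u (∈-map⁺ (λ t → elements (u ∷ t)) (∈-vecs⁺ t (S⊆s ∘ t⊆S)))) first

-- The union bound

module _ {n p : ℕ} where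

  open Derandomization (_≟ˢ_ {n})
  open Formula n p
  open DecMembership (Finₚ._≟_ {n}) using () renaming (_∈?_ to _∈ᴸ?_)

  -- Pigeonhole: sending each vertex to a position in `outsiders s ++ s` is injective.
  n≤outsiders+s : ∀ s → n ℕ.≤ length (outsiders s) ℕ.+ length s
  n≤outsiders+s s = subst (n ℕ.≤_) (Listₚ.length-++ (outsiders s))
    (Finₚ.injective⇒≤ {f = λ u → AnyL.index (cover u)} λ {u} {w} eq →
      trans (AnyLₚ.lookup-index (cover u))
        (trans (cong (List.lookup (outsiders s ++ s)) eq) (sym (AnyLₚ.lookup-index (cover w)))))
    where
    cover : ∀ u → u ∈ᴸ outsiders s ++ s
    cover u with u ∈ᴸ? s
    ... | yes u∈s = ∈-++⁺ʳ (outsiders s) u∈s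
    ... | no u∉s  = ∈-++⁺ˡ (∈-filter⁺ (λ u → ¬? (u ∈ᴸ? s)) (∈-allFin u) u∉s)

  total-≤ : ∀ {b} F → All (λ D → failures D ≤ b) F → total F ≤ ι (length F) * b
  total-≤ {b} []      []       = ℚₚ.≤-reflexive (sym (ℚₚ.*-zeroˡ b))
  total-≤ {b} (D ∷ F) (d ∷ ds) = begin
    failures D + total F       ≤⟨ ℚₚ.+-mono-≤ d (total-≤ F ds) ⟩
    b + ι (length F) * b       ≡⟨ cong (_+ ι (length F) * b) (ℚₚ.*-identityˡ b) ⟨
    1ℚ * b + ι (length F) * b  ≡⟨ ℚₚ.*-distribʳ-+ b 1ℚ (ι (length F)) ⟨
    (1ℚ + ι (length F)) * b    ≡⟨ cong (_* b) (ι-+ 1 (length F)) ⟨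
    ι (length (D ∷ F)) * b     ∎
    where open ℚₚ.≤-Reasoning

  -- There are n^k < 2^j summands, each a product over at least n - k outsiders and hence at most
  -- 2^-j.
  total-all-undominating<1 : ∀ {j k} → n ℕ.^ k ℕ.< 2 ℕ.^ j → 2 ℕ.^ (k ℕ.^ p) ℕ.* j ℕ.≤ n ∸ k →
                             total (all-undominating k) < 1ℚ
  total-all-undominating<1 {j} {k} n^k<2^j room = begin-strict
    total (all-undominating k)                       ≤⟨ total-≤ (all-undominating k) (AllLₚ.map⁺ (AllL.universal each _)) ⟩
    ι (length (all-undominating k)) * ½ ^ℚ j         ≡⟨ cong (λ l → ι l * ½ ^ℚ j) count ⟩
    ι (n ℕ.^ k) * ½ ^ℚ j                             <⟨ ℚₚ.*-monoˡ-<-pos (½ ^ℚ j) {{½^-pos j}} (ι-mono-< n^k<2^j) ⟩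
    ι (2 ℕ.^ j) * ½ ^ℚ j                             ≡⟨ ℚₚ.*-comm (ι (2 ℕ.^ j)) (½ ^ℚ j) ⟩
    ½ ^ℚ j * ι (2 ℕ.^ j)                             ≡⟨ ½^*2^ j ⟩
    1ℚ                                               ∎
    where
    open ℚₚ.≤-Reasoning
    ½^-pos : ∀ j → ℚ.Positive (½ ^ℚ j)
    ½^-pos zero    = _
    ½^-pos (suc j) = ℚₚ.pos*pos⇒pos ½ (½ ^ℚ j) {{½^-pos j}}
    count : length (all-undominating k) ≡ n ℕ.^ k
    count = trans (Listₚ.length-map _ (vecs (allFin n) k))
      (trans (length-vecs (allFin n) k) (cong (ℕ._^ k) (Listₚ.length-tabulate {n = n} λ i → i)))
    each : ∀ v → failures (undominating (toList v)) ≤ ½ ^ℚ j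
    each v rewrite failures-undominating (toList v) | Vecₚ.length-toList v =
      [1-½^K]^N≤½^j (k ℕ.^ p) (ℕₚ.≤-trans room (ℕₚ.m≤n+o⇒m∸n≤o n k (subst (n ℕ.≤_)
        (trans (cong (length (outsiders (toList v)) ℕ.+_) (Vecₚ.length-toList v)) (ℕₚ.+-comm _ k))
        (n≤outsiders+s (toList v)))))

-- Lower bound for Γ and comparison with the logarithm

m≤m^[1+n] : ∀ m n → m ℕ.≤ m ℕ.^ suc n
m≤m^[1+n] zero    n = z≤n
m≤m^[1+n] (suc m) n = ℕₚ.m≤m*n (suc m) (suc m ℕ.^ n) {{ℕₚ.m^n≢0 (suc m) n}}

not-dominating⇒<Γ : ∀ {n r} q k (𝓗 : Hypergraph n r) →
                    (∃ λ D → ∀ S → ∣ S ∣ ℕ.≤ k → ¬ Dominating 𝓗 q D S) → k ℕ.< Γ q 𝓗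
not-dominating⇒<Γ q k 𝓗 (D , not-dominating) = ℕₚ.<-≤-trans (k<γ (γ-attained 𝓗 q D)) (Γ-greatest q 𝓗 D)
  where
  k<γ : (∃ λ S → Dominating 𝓗 q D S × ∣ S ∣ ≡ γ 𝓗 q D) → k ℕ.< γ 𝓗 q D
  k<γ (S , dom , ∣S∣≡γ) = ℕₚ.≰⇒> λ γ≤k → not-dominating S (subst (ℕ._≤ k) (sym ∣S∣≡γ) γ≤k) dom

k<Γ : ∀ {n p k} → Fin n → 2 ℕ.^ (7 ℕ.* k ℕ.^ suc p) ℕ.≤ n → k ℕ.< Γ (suc p) (H n (suc (suc p)))
k<Γ {n} {p} {k} v₀ large = not-dominating⇒<Γ (suc p) k (H n (suc (suc p)))
  (exists (enough-vertices (m≤m^[1+n] k p) large))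
  where
  exists : (∃ λ j → n ℕ.^ k ℕ.< 2 ℕ.^ j × 2 ℕ.^ (k ℕ.^ suc p) ℕ.* j ℕ.≤ n ∸ k) →
           ∃ λ (D : Orientation (H n (suc (suc p)))) →
             ∀ S → ∣ S ∣ ℕ.≤ k → ¬ Dominating (H n (suc (suc p))) (suc p) D S
  exists (j , n^k<2^j , room) =
    small-sets-not-dominating {p = p} k v₀ (total-all-undominating<1 {n} {suc p} {j} {k} n^k<2^j room)

-- Taking k to be Γ itself in `k<Γ` would give Γ < Γ, so no optimal k has to be computed.
¬-2^7K≤n : ∀ {n p} → Fin n → ¬ 2 ℕ.^ (7 ℕ.* Γ (suc p) (H n (suc (suc p))) ℕ.^ suc p) ℕ.≤ n
¬-2^7K≤n {p = p} v₀ large = ℕₚ.<-irrefl refl (k<Γ {p = p} v₀ large)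

-- If 14k < t, then τ ≥ (14k)^(p+1) ≥ 2 · 7K for K = k^(p+1), so a partial sum of exp τ reaches
-- 2^(7K) and n ≥ 2^(7K). The 14 is this 2, from `2^N≤expSum`, times the 7 of `enough-vertices`.
exp-bound : ∀ {n p k t τ} → ¬ 2 ℕ.^ (7 ℕ.* k ℕ.^ suc p) ℕ.≤ n →
            0ℚ ≤ t → t ^ℚ suc p < τ → ExpBelow n τ → t ≤ ι (14 ℕ.* k)
exp-bound {n} {p} {k} {t} {τ} small 0≤t t^<τ exp≤n = ℚₚ.≮⇒≥ λ 14k<t → small
  (ι-cancel-≤ (ℚₚ.≤-trans (2^N≤expSum (7 ℕ.* K) (begin
    ι (2 ℕ.* (7 ℕ.* K))         ≤⟨ ι-mono-≤ 14K≤[14k]^ ⟩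
    ι ((14 ℕ.* k) ℕ.^ suc p)    ≡⟨ ι-^ (14 ℕ.* k) (suc p) ⟩
    ι (14 ℕ.* k) ^ℚ suc p       ≤⟨ ^-monoˡ-≤ (0≤ι (14 ℕ.* k)) (ℚₚ.<⇒≤ 14k<t) (suc p) ⟩
    t ^ℚ suc p                  ≤⟨ ℚₚ.<⇒≤ t^<τ ⟩
    τ                           ∎)) (exp≤n (7 ℕ.* K))))
  where
  open ℚₚ.≤-Reasoning
  K : ℕ
  K = k ℕ.^ suc p
  14K≤[14k]^ : 2 ℕ.* (7 ℕ.* K) ℕ.≤ (14 ℕ.* k) ℕ.^ suc p
  14K≤[14k]^ = ℕₚ.≤-trans (ℕₚ.≤-reflexive (sym (ℕₚ.*-assoc 2 7 K)))
    (ℕₚ.≤-trans (ℕₚ.*-monoˡ-≤ K (m≤m^[1+n] 14 p)) (ℕₚ.≤-reflexive (sym (^-distribʳ-* 14 k (suc p)))))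

-- The constant c, cancelling the 14 of `exp-bound`; it is the same for all r.
1/14 : ℚ
1/14 = + 1 / 14

1/14ℝ : ℝ≥0
1/14ℝ = sup (_≡ 1/14) (1/14 , ℚₚ.nonNegative⁻¹ 1/14 , λ { _ refl → ℚₚ.≤-refl })

0<1/14ℝ : fromℕ 0 <ℝ 1/14ℝ
0<1/14ℝ = 0ℚ , not-below , inj₂ (1/14 , refl , ℚₚ.positive⁻¹ 1/14)
  where
  not-below : ¬ Below (fromℕ 0) 0ℚ
  not-below (inj₁ 0<0)              = ℚₚ.<-irrefl refl 0<0
  not-below (inj₂ (_ , refl , 0<0)) = ℚₚ.<-irrefl refl 0<0

below-1/14ℝ⇒≤ : ∀ {a} → Below 1/14ℝ a → a ≤ 1/14
below-1/14ℝ⇒≤ (inj₁ a<0)                = ℚₚ.≤-trans (ℚₚ.<⇒≤ a<0) (ℚₚ.nonNegative⁻¹ 1/14)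
below-1/14ℝ⇒≤ (inj₂ (_ , refl , a<1/14)) = ℚₚ.<⇒≤ a<1/14

module _ {n p k : ℕ} (small : ¬ 2 ℕ.^ (7 ℕ.* k ℕ.^ suc p) ℕ.≤ n) where

  below-root-ln⇒≤ : ∀ {b} → Below (root (suc p) (ln n)) b → b ≤ ι (14 ℕ.* k)
  below-root-ln⇒≤ (inj₁ b<0) = ℚₚ.≤-trans (ℚₚ.<⇒≤ b<0) (0≤ι (14 ℕ.* k))
  -- The cut of `ln n` contains all negative rationals, but a power of t ≥ 0 is not negative.
  below-root-ln⇒≤ (inj₂ (t , (0≤t , inj₁ t^<0) , b<t)) =
    contradiction (ℚₚ.≤-<-trans (0≤^ 0≤t (suc p)) t^<0) (ℚₚ.<-irrefl refl)
  below-root-ln⇒≤ (inj₂ (t , (0≤t , inj₂ (τ , (_ , exp≤n) , t^<τ)) , b<t)) =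
    ℚₚ.≤-trans (ℚₚ.<⇒≤ b<t) (exp-bound {n} {p} {k} {t} {τ} small 0≤t t^<τ exp≤n)

  root-ln/14≤k : 1/14ℝ *ℝ root (suc p) (ln n) ≤ℝ fromℕ k
  root-ln/14≤k q (inj₁ q<0) = inj₁ q<0
  root-ln/14≤k q (inj₂ (_ , (a , b , (0≤a , a∈1/14) , (0≤b , b<root) , refl) , q<ab)) =
    inj₂ (ι k , refl , ℚₚ.<-≤-trans q<ab (begin
      a * b                   ≤⟨ *-mono-≤ 0≤a (0≤ι (14 ℕ.* k)) (below-1/14ℝ⇒≤ a∈1/14) (below-root-ln⇒≤ b<root) ⟩
      1/14 * ι (14 ℕ.* k)     ≡⟨ cong (1/14 *_) (ι-* 14 k) ⟩
      1/14 * (ι 14 * ι k)     ≡⟨ ℚₚ.*-assoc 1/14 (ι 14) (ι k) ⟨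
      1ℚ * ι k                ≡⟨ ℚₚ.*-identityˡ (ι k) ⟩
      ι k                     ∎))
    where open ℚₚ.≤-Reasoning

mainTheorem2 : (r : ℕ) (r≥2 : r ≥ 2) →
    Σ[ c ∈ ℝ≥0 ] (fromℕ 0 <ℝ c ×
    ((n : ℕ) → n ≥ r →
    c *ℝ root (r ∸ 1) {{nonZero-∸1 r≥2}} (ln n) ≤ℝ fromℕ (Γ (r ∸ 1) (H n r))))
mainTheorem2 (suc (suc p)) (s≤s (s≤s z≤n)) = 1/14ℝ , 0<1/14ℝ , λ n n≥r →
  -- Since n ≥ r ≥ 2, there is a vertex to pad with.
  root-ln/14≤k {n} {p} {Γ (suc p) (H n (suc (suc p)))} (¬-2^7K≤n {n} {p} (fromℕ< (ℕₚ.≤-trans (s≤s z≤n) n≥r)))
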